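{- Let $T_1,T_2$ be trees on $n$ vertices such that $T_2$ covers $T_1$ in $\mathsf{GTS}_n$, and let the covering be witnessed by a generalized tree shift of $T_1$ along a path $P_k$ from vertex $1$ to vertex $k$ (internal vertices of degree $2$ in $T_1$, neither $1$ nor $k$ a leaf of $T_1$), producing $T_2$. Let $H_1$ and $H_2$ be the connected components of $T_1-E(P_k)$ containing $1$ and $k$ respectively. Then for every $q\in\mathbb{R}\setminus\{0\}$, as rational functions of $x$, $$f^{\mathcal{L}_{T_1}^{q}}(q,x)-f^{\mathcal{L}_{T_2}^{q}}(q,x)=-\frac{1}{q^2x}\,\mathcal{F}_{P_k}^{1}(q,x)\,\mathcal{F}_{H_1}^{1}(q,x)\,\mathcal{F}_{H_2}^{k}(q,x),$$ where in $\mathcal{F}_{P_k}^{1}$ the distinguished vertex is the endpoint $1$ of the path, in $\mathcal{F}_{H_1}^1$ it is vertex $1$, and in $\mathcal{F}_{H_2}^k$ it is vertex $k$.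
   Context: For a tree $T$ with degree matrix $D$ and adjacency matrix $A$, $\mathcal{L}_T^q=I+q^2(D-I)-qA$. $f^{\mathcal{L}_T^q}(q,x)=\det(xI-\mathcal{L}_T^q)$; for a vertex $v$, $\mathcal{L}_T^q|v$ is the principal submatrix obtained by deleting row and column $v$, and $f^{\mathcal{L}_T^q|v}(q,x)=\det(xI-\mathcal{L}_T^q|v)$. The auxiliary polynomial is $\mathcal{F}_T^v(q,x)=f^{\mathcal{L}_T^q}(q,x)-(x+q^2-1)f^{\mathcal{L}_T^q|v}(q,x)$. Generalized tree shift: for a tree $T$ and distinct vertices $u,w$ such that each internal vertex of the $u$–$w$ path $P$ has degree 2, with $w'$ the neighbour of $w$ on $P$, replace each edge $\{w,z\}$, $z\ne w'$, by $\{u,z\}$. $\mathsf{GTS}_n$: partial order on isomorphism classes of $n$-vertex trees, $T_1\le T_2$ iff $T_2$ arises from $T_1$ by finitely many generalized tree shifts; $T_2$ covers $T_1$ if $T_1\le T_2$, $T_1\ne T_2$, and no tree lies strictly between them. -}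

module Defs where

open import Level using (Level)
open import Data.Bool using (Bool; _≟_; true; false; if_then_else_; _∧_; _∨_; not)
open import Data.Nat as ℕ using (ℕ; zero; suc; _≤_)
open import Data.Fin as Fin using (Fin; zero; suc; inject₁; fromℕ; punchIn; toℕ)
open import Data.List as List using (List; []; _∷_; allFin; filter; length)
open import Data.List.Relation.Unary.Any using (any?)
open import Data.Product using (Σ; ∃; _×_; _,_)
open import Data.Sum using (_⊎_)
open import Function using (_⇔_; _↔_)
open import Function.Bundles using (Inverse)
open import Function.Definitions using (Injective)
open import Relation.Nullary using (¬_; does)
open import Relation.Binary.PropositionalEquality using (_≡_; _≢_)
open import Relation.Binary.Construct.Closure.ReflexiveTransitive using (Star)
open import Algebra.Apartness.Bundles using (HeytingField)

Graph : ℕ → Set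
Graph n = Fin n → Fin n → Bool

_==_ : ∀ {n} → Fin n → Fin n → Bool
a == b = does (a Fin.≟ b)

countTrue : List Bool → ℕ
countTrue [] = 0
countTrue (true ∷ bs) = suc (countTrue bs)
countTrue (false ∷ bs) = countTrue bs

deg : ∀ {n} → Graph n → Fin n → ℕ
deg G v = countTrue (List.map (G v) (allFin _))

sumℕ : List ℕ → ℕ
sumℕ = List.foldr ℕ._+_ 0

data Walk {n} (G : Graph n) : Fin n → Fin n → Set where
  here : ∀ {v} → Walk G v v
  step : ∀ {u v w} → G u v ≡ true → Walk G v w → Walk G u w

record IsTree {n} (G : Graph n) : Set where
  field
    nonempty  : 1 ≤ n
    symmetric : ∀ u v → G u v ≡ G v u
    loopless  : ∀ v → G v v ≡ false
    connected : ∀ u v → Walk G u v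
    edgeCount : sumℕ (List.map (deg G) (allFin n)) ≡ 2 ℕ.* (n ℕ.∸ 1)

Iso : ∀ {n} → Graph n → Graph n → Set
Iso {n} G H = Σ (Fin n ↔ Fin n) λ σ → ∀ a b → G a b ≡ H (Inverse.to σ a) (Inverse.to σ b)

record Path {n} (G : Graph n) (m : ℕ) : Set where
  field
    vtx      : Fin (suc (suc m)) → Fin n
    injective : Injective _≡_ _≡_ vtx
    adjacent : ∀ (i : Fin (suc m)) → G (vtx (inject₁ i)) (vtx (suc i)) ≡ true

  start : Fin n
  start = vtx zero

  end : Fin n
  end = vtx (fromℕ (suc m))

  endNbr : Fin n
  endNbr = vtx (inject₁ (fromℕ m))

  InternalDeg2 : Set
  InternalDeg2 = ∀ (i : Fin m) → deg G (vtx (suc (inject₁ i))) ≡ 2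

  onPath : Fin n → Bool
  onPath v = does (any? (λ i → vtx i Fin.≟ v) (allFin _))

  pathEdge : Fin n → Fin n → Bool
  pathEdge a b = does (any? (λ i → _≟_
                   ((vtx (inject₁ i) == a ∧ vtx (suc i) == b) ∨
                    (vtx (inject₁ i) == b ∧ vtx (suc i) == a)) true) (allFin _))

  pathGraph : Graph n
  pathGraph = pathEdge

  minusPath : Graph n
  minusPath a b = G a b ∧ not (pathEdge a b)


-- Generalized tree shift of T along a path from u to w (w' the
-- neighbour of w on the path): each edge {w,z}, z ≠ w', becomes {u,z}.

shiftGraph : ∀ {n} → Graph n → (u w w' : Fin n) → Graph n
shiftGraph T u w w' a b =
  if a == w then (b == w' ∧ T a b) else
  if b == w then (a == w' ∧ T a b) else
  if a == u then (T a b ∨ (T w b ∧ not (b == w'))) else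
  if b == u then (T a b ∨ (T w a ∧ not (a == w'))) else
  T a b

shiftAlong : ∀ {n} {T : Graph n} {m} → Path T m → Graph n
shiftAlong {T = T} P = shiftGraph T (Path.start P) (Path.end P) (Path.endNbr P)

GTSStep : ∀ {n} → Graph n → Graph n → Set
GTSStep {n} T T' = Σ ℕ λ m → Σ (Path T m) λ P →
  Path.InternalDeg2 P × (T' ≡ shiftAlong P)

-- the order of GTS_n on isomorphism classes of trees:
-- T₁ ≤ T₂ iff T₂ is obtained (up to isomorphism) from T₁ by finitely many shifts
_≤GTS_ : ∀ {n} → Graph n → Graph n → Set
_≤GTS_ = Star (λ A B → Iso A B ⊎ GTSStep A B)

Covers : ∀ {n} → Graph n → Graph n → Set
Covers {n} T₂ T₁ =
  (T₁ ≤GTS T₂) × ¬ Iso T₁ T₂ ×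
  (∀ (T : Graph n) → IsTree T → T₁ ≤GTS T → T ≤GTS T₂ → Iso T T₁ ⊎ Iso T T₂)

module WithField {c ℓ₁ ℓ₂ : Level} (F : HeytingField c ℓ₁ ℓ₂) where
  open HeytingField F using (Carrier; _+_; _*_; -_; _-_; 0#; 1#)

  sumK : List Carrier → Carrier
  sumK = List.foldr _+_ 0#

  det : ∀ m → (Fin m → Fin m → Carrier) → Carrier
  det zero M = 1#
  det (suc m) M = sumK (List.map term (allFin (suc m)))
    where
      sign : ℕ → Carrier → Carrier
      sign zero a = a
      sign (suc zero) a = - a
      sign (suc (suc k)) a = sign k a
      term : Fin (suc m) → Carrier
      term j = sign (toℕ j) (M zero j * det m (λ i k → M (suc i) (punchIn j k)))

  detOn : ∀ {n} → (Fin n → Bool) → (Fin n → Fin n → Carrier) → Carrier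
  detOn {n} S M = det (length vs) (λ i j → M (List.lookup vs i) (List.lookup vs j))
    where
      vs : List (Fin n)
      vs = filter (λ v → S v ≟ true) (allFin n)

  b2K : Bool → Carrier
  b2K true = 1#
  b2K false = 0#

  -- q-Laplacian of the graph G restricted to the vertex set S:
  -- I + q²(D - I) - qA  (degrees counted inside S)
  qLap : ∀ {n} → Graph n → (Fin n → Bool) → Carrier → Fin n → Fin n → Carrier
  qLap {n} G S q a b =
    if a == b
    then 1# + (q * q) * (degK - 1#)
    else - (q * b2K (G a b))
    where
      degK : Carrier
      degK = sumK (List.map (λ v → b2K (S v ∧ G a v)) (allFin n))

  -- f^{L_H^q}(q,x) = det(xI - L_H^q) for the graph H = (S , G|S)
  charPoly : ∀ {n} → Graph n → (Fin n → Bool) → Carrier → Carrier → Carrier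
  charPoly G S q x =
    detOn S (λ a b → (if a == b then x else 0#) - qLap G S q a b)

  charPolyDel : ∀ {n} → Graph n → (Fin n → Bool) → Fin n → Carrier → Carrier → Carrier
  charPolyDel G S v q x =
    detOn (λ a → S a ∧ not (a == v))
          (λ a b → (if a == b then x else 0#) - qLap G S q a b)

  auxPoly : ∀ {n} → Graph n → (Fin n → Bool) → Fin n → Carrier → Carrier → Carrier
  auxPoly G S v q x =
    charPoly G S q x - ((x + q * q - 1#) * charPolyDel G S v q x)

  allV : ∀ {n} → Fin n → Bool
  allV _ = true

  open HeytingField F using (_≈_)

  -- the identity of Theorem 3.4, multiplied through by q² x:
  -- q² x (f^{L_{T₁}} - f^{L_{T₂}}) = - F_{P}^{start} F_{H₁}^{start} F_{H₂}^{end}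
  GTSIdentity : ∀ {n} (T₁ T₂ : Graph n) {m} (P : Path T₁ m)
                (S₁ S₂ : Fin n → Bool) (q x : Carrier) → Set ℓ₁
  GTSIdentity T₁ T₂ P S₁ S₂ q x =
    ((q * q) * x) * (charPoly T₁ allV q x - charPoly T₂ allV q x)
      ≈ - ((auxPoly (Path.pathGraph P) (Path.onPath P) (Path.start P) q x
            * auxPoly (Path.minusPath P) S₁ (Path.start P) q x)
            * auxPoly (Path.minusPath P) S₂ (Path.end P) q x)

{-# OPTIONS --safe #-}
module Submission where

open import Defs
open import Data.Bool using (Bool; true)
open import Data.Nat using (ℕ; _≤_)
open import Data.Fin using (Fin)
open import Function using (_⇔_)
open import Relation.Binary.PropositionalEquality using (_≡_)
open import Algebra.Apartness.Bundles using (HeytingField)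

open import Level using (Level; _⊔_)
open import Algebra.Apartness.Bundles using (HeytingCommutativeRing)
open import Algebra.Bundles using (CommutativeRing; RawRing)
open import Algebra.Solver.Ring.AlmostCommutativeRing
  using (fromCommutativeRing; _-Raw-AlmostCommutative⟶_)
import Algebra.Solver.Ring as RingSolver
open import Data.Bool using (false; _∧_; _∨_; not; if_then_else_; _≟_)
import Data.Bool.Properties as Bool
open import Data.Empty using (⊥-elim)
open import Data.Fin as Fin using (zero; suc; inject₁; fromℕ; toℕ; punchIn)
import Data.Fin.Properties as Fin
open import Data.Fin.Relation.Unary.Top using (view; ‵fromℕ; ‵inject₁)
open import Data.List as List using (List; []; _∷_; _++_; allFin; map; filter; length; tabulate)
import Data.List.Properties as List
open import Data.List.Membership.Propositional using (_∈_; _∉_; find; lose)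
open import Data.List.Membership.Propositional.Properties
  using (∈-allFin; ∈-filter⁺; ∈-filter⁻; ∈-++⁺ˡ; ∈-++⁺ʳ; ∈-++⁻; ∈-∃++; ∈-tabulate⁺; ∈-tabulate⁻)
open import Data.List.Membership.Propositional.Properties.WithK using (unique∧set⇒bag)
open import Data.List.Relation.Binary.BagAndSetEquality using (∼bag⇒↭)
open import Data.List.Relation.Binary.Permutation.Propositional as ↭ using (_↭_)
import Data.List.Relation.Binary.Permutation.Propositional.Properties as ↭
import Data.List.Relation.Binary.Permutation.Setoid.Properties as ↭ₛ
open import Data.List.Relation.Binary.Pointwise as Pointwise using (Pointwise; []; _∷_)
open import Data.List.Relation.Unary.All as All using (All; []; _∷_)
open import Data.List.Relation.Unary.AllPairs using (_∷_)
open import Data.List.Relation.Unary.Any using (any?; here; there)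
open import Data.List.Relation.Unary.Unique.Propositional using (Unique)
import Data.List.Relation.Unary.Unique.Propositional.Properties as Unique
open import Data.Maybe using (Maybe; just; nothing)
open import Data.Nat as ℕ using (zero; suc; s≤s; z≤n)
import Data.Nat.Properties as ℕ
open import Data.Nat.ListAction using (sum)
open import Data.Nat.ListAction.Properties using (sum-↭)
open import Data.Nat.Solver using (module +-*-Solver)
open import Data.Product using (∃; ∃-syntax; _,_; proj₁; proj₂) renaming (_×_ to _⊗_)
open import Data.Sum using (_⊎_; inj₁; inj₂)
open import Function using (_∘_; id; mk⇔; Equivalence)
open import Function.Definitions using (Injective)
open import Relation.Binary.Definitions using (DecidableEquality)
open import Relation.Binary.PropositionalEquality as ≡ using (_≢_)
open import Relation.Nullary using (¬_; Dec; yes; no; does)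

-- For a vertex v and a vertex list A write a minor on v ∷ A as M v v · det A + Y(A), where Y(A)
-- does not involve M v v. If v separates A from B, then Y(A ++ B) = Y(A) det B + det A Y(B), by
-- splitting the row of v and using that each half is block triangular. Applied at the two ends of
-- the path in T₁, and twice at its start in T₂, this expresses both characteristic polynomials
-- through det and Y of the branches H₁ and H₂ and the tridiagonal determinants of the path;
-- moving H₂ changes neither its det nor its Y. The theorem is then a polynomial identity,
-- which rests on F_P = − q² x E, with E the determinant of the interior of the path.
-- That the branches are disjoint is a matter of counting: a second connection between the ends
-- of the path would leave T₁ connected after the loss of an edge.

-- With δ d = x - 1 - q²(d - 1) for the diagonal entry at a vertex of degree d, the constant x + q²
-- - 1 of the auxiliary polynomial is δ 0. Subtracting it times the deleted minor therefore leaves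
-- F_H = Y - q² d D for a branch whose root has degree d inside it. On the path, t = δ 1 - q² makes
-- everything except -q² x E cancel. Up to the factor q² x the claim thus reads f - f′ = E (Y₁ - q²
-- d₁ D₁)(Y₂ - q² d₂ D₂). Since δ is affine in d, the shift preserves the sum of the diagonal
-- entries at the two ends of the path and changes their product by q⁴ d₁ d₂. This is the D₁ D₂
-- term, and E⁻ drops out of the difference. Hence E and E⁻, the latter being the tridiagonal
-- determinant one size smaller, can be independent unknowns, and one identity serves paths of every
-- length. Minors are indexed by lists of vertices, so that cutting a tree becomes concatenation and
-- reordering its vertices becomes a permutation of lists.

-- Coefficients for the ring solver: the pair (a , b) stands for a·1 − b·1, so that a − a is
-- recognised as zero although equality in the ring is not decidable.
module DifferenceSolver {c ℓ} (R : CommutativeRing c ℓ) where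
  open CommutativeRing R
  open import Algebra.Properties.Ring ring
  open import Algebra.Properties.CommutativeSemigroup +-commutativeSemigroup using (interchange)
  open import Algebra.Properties.Semiring.Mult.TCOptimised semiring
  open import Relation.Binary.Reasoning.Setoid setoid

  coeffs : RawRing _ _
  coeffs = record
    { Carrier = ℕ ⊗ ℕ
    ; _≈_ = λ (a , b) (c , d) → a ℕ.+ d ≡ c ℕ.+ b
    ; _+_ = λ (a , b) (c , d) → a ℕ.+ c , b ℕ.+ d
    ; _*_ = λ (a , b) (c , d) → a ℕ.* c ℕ.+ b ℕ.* d , a ℕ.* d ℕ.+ b ℕ.* c
    ; -_ = λ (a , b) → b , a
    ; 0# = 0 , 0
    ; 1# = 1 , 0
    }

  ι : ℕ → Carrier
  ι n = n × 1#

  -- The case of second component zero is separate so that the constants `:0` and `:1` evaluate to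
  -- `0#` and `1#` by computation, and solved equations match the goals as written.
  ⟦_⟧ : ℕ ⊗ ℕ → Carrier
  ⟦ a , zero ⟧ = ι a
  ⟦ a , suc b ⟧ = ι a - ι (suc b)

  ⟦⟧-diff : ∀ a b → ⟦ a , b ⟧ ≈ ι a - ι b
  ⟦⟧-diff a zero = sym (trans (+-congˡ -0#≈0#) (+-identityʳ _))
  ⟦⟧-diff a (suc b) = refl

  diff-+ : ∀ a b c d → (a + c) - (b + d) ≈ (a - b) + (c - d)
  diff-+ a b c d = trans (+-congˡ (sym (-‿+-comm b d))) (interchange a c (- b) (- d))

  diff-* : ∀ a b c d → (a * c + b * d) - (a * d + b * c) ≈ (a - b) * (c - d)
  diff-* a b c d = begin
    (a * c + b * d) - (a * d + b * c)     ≈⟨ diff-+ _ _ _ _ ⟩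
    (a * c - a * d) + (b * d - b * c)     ≈⟨ +-congˡ (-‿involutive _) ⟨
    (a * c - a * d) - - (b * d - b * c)   ≈⟨ +-congˡ (-‿cong (⁻¹-anti-homo‿- _ _)) ⟩
    (a * c - a * d) - (b * c - b * d)     ≈⟨ +-cong (x[y-z]≈xy-xz a c d) (-‿cong (x[y-z]≈xy-xz b c d)) ⟨
    a * (c - d) - b * (c - d)             ≈⟨ [y-z]x≈yx-zx (c - d) a b ⟨
    (a - b) * (c - d)                     ∎

  morphism : coeffs -Raw-AlmostCommutative⟶ fromCommutativeRing R
  morphism = record
    { ⟦_⟧ = ⟦_⟧
    ; +-homo = λ (a , b) (c , d) → begin
        ⟦ a ℕ.+ c , b ℕ.+ d ⟧             ≈⟨ ⟦⟧-diff (a ℕ.+ c) (b ℕ.+ d) ⟩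
        ι (a ℕ.+ c) - ι (b ℕ.+ d)         ≈⟨ diff-cong (×-homo-+ 1# a c) (×-homo-+ 1# b d) ⟩
        (ι a + ι c) - (ι b + ι d)         ≈⟨ diff-+ _ _ _ _ ⟩
        (ι a - ι b) + (ι c - ι d)         ≈⟨ +-cong (⟦⟧-diff a b) (⟦⟧-diff c d) ⟨
        ⟦ a , b ⟧ + ⟦ c , d ⟧             ∎
    ; *-homo = λ (a , b) (c , d) → begin
        ⟦ a ℕ.* c ℕ.+ b ℕ.* d , a ℕ.* d ℕ.+ b ℕ.* c ⟧   ≈⟨ ⟦⟧-diff (a ℕ.* c ℕ.+ b ℕ.* d) (a ℕ.* d ℕ.+ b ℕ.* c) ⟩
        ι (a ℕ.* c ℕ.+ b ℕ.* d) - ι (a ℕ.* d ℕ.+ b ℕ.* c) ≈⟨ diff-cong (dot a c b d) (dot a d b c) ⟩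
        (ι a * ι c + ι b * ι d) - (ι a * ι d + ι b * ι c) ≈⟨ diff-* _ _ _ _ ⟩
        (ι a - ι b) * (ι c - ι d)         ≈⟨ *-cong (⟦⟧-diff a b) (⟦⟧-diff c d) ⟨
        ⟦ a , b ⟧ * ⟦ c , d ⟧             ∎
    ; -‿homo = λ (a , b) → begin
        ⟦ b , a ⟧                         ≈⟨ ⟦⟧-diff b a ⟩
        ι b - ι a                         ≈⟨ ⁻¹-anti-homo‿- _ _ ⟨
        - (ι a - ι b)                     ≈⟨ -‿cong (⟦⟧-diff a b) ⟨
        - ⟦ a , b ⟧                       ∎
    ; 0-homo = refl
    ; 1-homo = refl
    }
    where
    diff-cong : ∀ {x y u v} → x ≈ y → u ≈ v → x - u ≈ y - v
    diff-cong p q = +-cong p (-‿cong q)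
    dot : ∀ a b c d → ι (a ℕ.* b ℕ.+ c ℕ.* d) ≈ ι a * ι b + ι c * ι d
    dot a b c d = trans (×-homo-+ 1# (a ℕ.* b) (c ℕ.* d)) (+-cong (×1-homo-* a b) (×1-homo-* c d))

  -- The equation a + d = c + b in ℕ suffices in every ring. In positive characteristic it is not
  -- necessary, which the result type `Maybe` allows for.
  coeff≟ : ∀ x y → Maybe (⟦ x ⟧ ≈ ⟦ y ⟧)
  coeff≟ (a , b) (c , d) with a ℕ.+ d ℕ.≟ c ℕ.+ b
  ... | no _ = nothing
  ... | yes e = just (begin
      ⟦ a , b ⟧                      ≈⟨ ⟦⟧-diff a b ⟩
      ι a - ι b                      ≈⟨ +-congʳ (trans (+-assoc _ _ _) (trans (+-congˡ (-‿inverseʳ _)) (+-identityʳ _))) ⟨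
      (ι a + ι d - ι d) - ι b        ≈⟨ +-congʳ (+-congʳ (trans (sym (×-homo-+ 1# a d)) (trans (reflexive (≡.cong ι e)) (×-homo-+ 1# c b)))) ⟩
      (ι c + ι b - ι d) - ι b        ≈⟨ +-assoc _ _ _ ⟩
      (ι c + ι b) + (- ι d - ι b)    ≈⟨ +-congˡ (-‿+-comm _ _) ⟩
      (ι c + ι b) - (ι d + ι b)      ≈⟨ diff-+ _ _ _ _ ⟩
      (ι c - ι d) + (ι b - ι b)      ≈⟨ trans (+-congˡ (-‿inverseʳ _)) (+-identityʳ _) ⟩
      ι c - ι d                      ≈⟨ ⟦⟧-diff c d ⟨
      ⟦ c , d ⟧                      ∎)

  open RingSolver coeffs (fromCommutativeRing R) morphism coeff≟ public
    using (Polynomial; solve; con; _:+_; _:*_; _:-_; :-_; _:=_)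

  :0 :1 : ∀ {n} → Polynomial n
  :0 = con (0 , 0)
  :1 = con (1 , 0)

-- Determinants over lists of labels, and their splitting at a cut vertex.

module ListDeterminant {c ℓ} (R : CommutativeRing c ℓ) where
  open CommutativeRing R renaming (Carrier to K)
  open DifferenceSolver R using (solve; _:+_; _:*_; _:-_; :-_; _:=_; :0; :1)
  open import Relation.Binary.Reasoning.Setoid setoid

  private variable
    j r : Level
    J J′ : Set j

  -- Laplace expansion along a row `m`, with the cofactor an arbitrary function `f` of the remaining
  -- columns; the nested subtraction produces the alternating signs. With `f` abstract, linearity
  -- and antisymmetry follow by induction on the columns alone.
  expand : (J → K) → (List J → K) → List J → K
  expand m f [] = 0#
  expand m f (c ∷ cs) = m c * f cs - expand m (λ l → f (c ∷ l)) cs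

  laplace : List (J → K) → List J → K
  laplace [] [] = 1#
  -- The value 0 on non-square data makes `laplace []` alternating, which is the base case of
  -- `laplace-alternating`.
  laplace [] (_ ∷ _) = 0#
  laplace (m ∷ ms) cs = expand m (laplace ms) cs

  minus-cong : ∀ {w x y z} → w ≈ x → y ≈ z → w - y ≈ x - z
  minus-cong p q = +-cong p (-‿cong q)

  -- The two column lists are matched by a relation instead of being equal, so that a column `v` of
  -- one matrix can later be compared with a different column `v′` of another.
  expand-cong : (_∼_ : J → J′ → Set r) {m : J → K} {m′ : J′ → K} {f : List J → K} {f′ : List J′ → K} →
    (∀ {c c′} → c ∼ c′ → m c ≈ m′ c′) → (∀ {l l′} → Pointwise _∼_ l l′ → f l ≈ f′ l′) →
    ∀ {cs cs′} → Pointwise _∼_ cs cs′ → expand m f cs ≈ expand m′ f′ cs′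
  expand-cong _∼_ p q [] = refl
  expand-cong _∼_ p q (e ∷ es) =
    minus-cong (*-cong (p e) (q es)) (expand-cong _∼_ p (λ es → q (e ∷ es)) es)

  laplace-cong : (_∼_ : J → J′ → Set r) {ms : List (J → K)} {ms′ : List (J′ → K)} →
    Pointwise (λ m m′ → ∀ {c c′} → c ∼ c′ → m c ≈ m′ c′) ms ms′ →
    ∀ {cs cs′} → Pointwise _∼_ cs cs′ → laplace ms cs ≈ laplace ms′ cs′
  laplace-cong _∼_ [] [] = refl
  laplace-cong _∼_ [] (_ ∷ _) = refl
  laplace-cong _∼_ (p ∷ ps) es = expand-cong _∼_ p (laplace-cong _∼_ ps) es

  -- The number of remaining columns is exposed because the induction in `laplace-block` needs its
  -- first block to stay square.
  expand-congʳ : ∀ m {f g : List J → K} cs → (∀ l → suc (length l) ≡ length cs → f l ≈ g l) →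
    expand m f cs ≈ expand m g cs
  expand-congʳ m [] p = refl
  expand-congʳ m (c ∷ cs) p =
    minus-cong (*-congˡ (p cs ≡.refl)) (expand-congʳ m cs (λ l e → p (c ∷ l) (≡.cong suc e)))

  -- The combination `k * f l - g l` is what an inner expansion becomes when its first column is
  -- peeled off; `expand-swap` uses it in this form.
  expand-linear : ∀ m k (f g : List J → K) cs →
    expand m (λ l → k * f l - g l) cs ≈ k * expand m f cs - expand m g cs
  expand-linear m k f g [] = solve 1 (λ k → :0 := k :* :0 :- :0) refl k
  expand-linear m k f g (c ∷ cs) = trans
    (minus-cong refl (expand-linear m k (λ l → f (c ∷ l)) (λ l → g (c ∷ l)) cs))
    (solve 6 (λ k a b d e h → a :* (k :* b :- d) :- (k :* e :- h) :=
                              k :* (a :* b :- e) :- (a :* d :- h)) refl k (m c) _ _ _ _)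

  expand-scale : ∀ m k (f : List J → K) cs → expand m (λ l → k * f l) cs ≈ k * expand m f cs
  expand-scale m k f [] = sym (zeroʳ k)
  expand-scale m k f (c ∷ cs) = trans
    (minus-cong refl (expand-scale m k (λ l → f (c ∷ l)) cs))
    (solve 4 (λ k a b d → a :* (k :* b) :- k :* d := k :* (a :* b :- d)) refl k (m c) _ _)

  expand-+ : ∀ m m′ (f : List J → K) cs →
    expand (λ c → m c + m′ c) f cs ≈ expand m f cs + expand m′ f cs
  expand-+ m m′ f [] = sym (+-identityˡ 0#)
  expand-+ m m′ f (c ∷ cs) = trans
    (minus-cong refl (expand-+ m m′ (λ l → f (c ∷ l)) cs))
    (solve 5 (λ a b d e h → (a :+ b) :* d :- (e :+ h) := a :* d :- e :+ (b :* d :- h)) refl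
      (m c) (m′ c) _ _ _)

  expand-zero : ∀ m (f : List J → K) {cs} → All (λ c → m c ≈ 0#) cs → expand m f cs ≈ 0#
  expand-zero m f [] = refl
  expand-zero m f (p ∷ ps) = trans (minus-cong (*-congʳ p) (expand-zero m _ ps))
    (solve 1 (λ a → :0 :* a :- :0 := :0) refl _)

  expand-++ : ∀ m (f : List J → K) cs {ds} → All (λ d → m d ≈ 0#) ds →
    expand m f (cs ++ ds) ≈ expand m (λ l → f (l ++ ds)) cs
  expand-++ m f [] ps = expand-zero m f ps
  expand-++ m f (c ∷ cs) ps = minus-cong refl (expand-++ m (λ l → f (c ∷ l)) cs ps)

  -- Adjacent exchanges suffice, since they generate `↭`. The sign is written as a factor so that it
  -- can be absorbed into `sign`.
  Alternating : (List J → K) → Set _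
  Alternating f = ∀ xs a b ys → f (xs ++ a ∷ b ∷ ys) ≈ - 1# * f (xs ++ b ∷ a ∷ ys)

  -- When the exchanged columns come first, the terms deleting `a` and `b` trade places with
  -- opposite signs; only the remaining terms use that `f` alternates.
  expand-alternating : ∀ m {f : List J → K} → Alternating f → Alternating (expand m f)
  expand-alternating m {f} alt [] a b ys = begin
    x - (y - expand m (λ l → f (a ∷ b ∷ l)) ys)
      ≈⟨ minus-cong refl (minus-cong refl (trans (expand-congʳ m ys (λ l _ → alt [] a b l)) (expand-scale m (- 1#) _ ys))) ⟩
    x - (y - - 1# * z)
      ≈⟨ solve 3 (λ x y z → x :- (y :- :- :1 :* z) := :- :1 :* (y :- (x :- z))) refl x y z ⟩
    - 1# * (y - (x - z)) ∎
    where
    x = m a * f (b ∷ ys)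
    y = m b * f (a ∷ ys)
    z = expand m (λ l → f (b ∷ a ∷ l)) ys
  expand-alternating m {f} alt (x ∷ xs) a b ys = trans
    (minus-cong (*-congˡ (alt xs a b ys)) (expand-alternating m (λ xs → alt (x ∷ xs)) xs a b ys))
    (solve 3 (λ m x y → m :* (:- :1 :* x) :- :- :1 :* y := :- :1 :* (m :* x :- y)) refl (m x) _ _)

  laplace-alternating : (ms : List (J → K)) → Alternating (laplace ms)
  laplace-alternating [] [] a b ys = sym (zeroʳ _)
  laplace-alternating [] (x ∷ xs) a b ys = sym (zeroʳ _)
  laplace-alternating (m ∷ ms) = expand-alternating m (laplace-alternating ms)

  -- Antisymmetry in the rows. The terms that give the first column to `m` on one side are those
  -- that give it to the same row on the other, with opposite sign, and the terms that give it to
  -- neither row are handled by induction.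
  expand-swap : ∀ m m′ (f : List J → K) cs →
    expand m (expand m′ f) cs ≈ - 1# * expand m′ (expand m f) cs
  expand-swap m m′ f [] = sym (zeroʳ _)
  expand-swap m m′ f (c ∷ cs) = begin
    m c * x - expand m (λ l → m′ c * f l - expand m′ f′ l) cs
      ≈⟨ minus-cong refl (trans (expand-linear m (m′ c) f (expand m′ f′) cs)
           (minus-cong refl (expand-swap m m′ f′ cs))) ⟩
    m c * x - (m′ c * y - - 1# * z)
      ≈⟨ solve 5 (λ a b x y z → a :* x :- (b :* y :- :- :1 :* z) := :- :1 :* (b :* y :- (a :* x :- z)))
           refl (m c) (m′ c) x y z ⟩
    - 1# * (m′ c * y - (m c * x - z))
      ≈⟨ *-congˡ (minus-cong refl (expand-linear m′ (m c) f (expand m f′) cs)) ⟨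
    - 1# * (m′ c * y - expand m′ (λ l → m c * f l - expand m f′ l) cs) ∎
    where
    f′ = λ l → f (c ∷ l)
    x = expand m′ f cs
    y = expand m f cs
    z = expand m′ (expand m f′) cs

  -- The sign belongs to the derivation of the permutation: with repeated entries it is not
  -- determined by the two lists. Rows and columns are always permuted by the same derivation, so
  -- only the square of the sign matters.
  sign : {xs ys : List J} → xs ↭ ys → K
  sign ↭.refl = 1#
  sign (↭.prep x p) = sign p
  sign (↭.swap x y p) = - 1# * sign p
  sign (↭.trans p q) = sign p * sign q

  sign² : {xs ys : List J} (p : xs ↭ ys) → sign p * sign p ≈ 1#
  sign² ↭.refl = *-identityˡ 1#
  sign² (↭.prep x p) = sign² p
  sign² (↭.swap x y p) = trans (solve 1 (λ s → (:- :1 :* s) :* (:- :1 :* s) := s :* s) refl _) (sign² p)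
  sign² (↭.trans p q) = trans
    (solve 2 (λ s t → (s :* t) :* (s :* t) := (s :* s) :* (t :* t)) refl _ _)
    (trans (*-cong (sign² p) (sign² q)) (*-identityˡ 1#))

  alternating-↭ : (f : List J → K) → Alternating f → ∀ {xs ys} (p : xs ↭ ys) → f xs ≈ sign p * f ys
  alternating-↭ f alt ↭.refl = sym (*-identityˡ _)
  alternating-↭ f alt (↭.prep x p) = alternating-↭ (λ l → f (x ∷ l)) (λ xs → alt (x ∷ xs)) p
  alternating-↭ f alt (↭.swap x y p) = trans (alt [] x y _)
    (trans (*-congˡ (alternating-↭ (λ l → f (y ∷ x ∷ l)) (λ xs → alt (y ∷ x ∷ xs)) p)) (sym (*-assoc _ _ _)))
  alternating-↭ f alt (↭.trans p q) =
    trans (alternating-↭ f alt p) (trans (*-congˡ (alternating-↭ f alt q)) (sym (*-assoc _ _ _)))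

  laplace-rows-↭ : (M : J → J′ → K) → ∀ {xs ys} (p : xs ↭ ys) cs →
    laplace (map M xs) cs ≈ sign p * laplace (map M ys) cs
  laplace-rows-↭ M ↭.refl cs = sym (*-identityˡ _)
  laplace-rows-↭ M (↭.prep x p) cs = trans
    (expand-congʳ (M x) cs (λ l _ → laplace-rows-↭ M p l)) (expand-scale (M x) (sign p) _ cs)
  laplace-rows-↭ M {x ∷ y ∷ xs} {_ ∷ _ ∷ ys} (↭.swap x y p) cs = begin
    expand (M x) (expand (M y) (laplace (map M xs))) cs
      ≈⟨ expand-swap (M x) (M y) _ cs ⟩
    - 1# * expand (M y) (expand (M x) (laplace (map M xs))) cs
      ≈⟨ *-congˡ (expand-congʳ (M y) cs λ l _ → trans
           (expand-congʳ (M x) l (λ l _ → laplace-rows-↭ M p l)) (expand-scale (M x) (sign p) _ l)) ⟩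
    - 1# * expand (M y) (λ l → sign p * expand (M x) (laplace (map M ys)) l) cs
      ≈⟨ *-congˡ (expand-scale (M y) (sign p) _ cs) ⟩
    - 1# * (sign p * expand (M y) (expand (M x) (laplace (map M ys))) cs)
      ≈⟨ *-assoc _ _ _ ⟨
    - 1# * sign p * expand (M y) (expand (M x) (laplace (map M ys))) cs ∎
  laplace-rows-↭ M (↭.trans p q) cs = trans (laplace-rows-↭ M p cs)
    (trans (*-congˡ (laplace-rows-↭ M q cs)) (sym (*-assoc _ _ _)))

  minor : (J → J → K) → List J → K
  minor M xs = laplace (map M xs) xs

  -- The row of `v` is a parameter apart from `M`, because `bordered-++` splits this row and leaves
  -- the column of `v` intact. For `m = M v` this is `minor M (v ∷ xs)` by computation.
  bordered : (J → K) → (J → J → K) → J → List J → K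
  bordered m M v xs = laplace (m ∷ map M xs) (v ∷ xs)

  -- Y(xs) of the opening remark, for a matrix whose row of v is m.
  offCorner : (J → K) → (J → J → K) → J → List J → K
  offCorner m M v xs = - expand m (λ l → laplace (map M xs) (v ∷ l)) xs

  private
    cancel-sign : ∀ {xs ys : List J} (p : xs ↭ ys) {a b d} →
      a ≈ sign p * b → b ≈ sign p * d → a ≈ d
    cancel-sign p e h = trans e (trans (*-congˡ h) (trans (sym (*-assoc _ _ _))
      (trans (*-congʳ (sign² p)) (*-identityˡ _))))

  minor-↭ : (M : J → J → K) → ∀ {xs ys} → xs ↭ ys → minor M xs ≈ minor M ys
  minor-↭ M {xs} {ys} p = cancel-sign p (laplace-rows-↭ M p xs)
    (alternating-↭ (laplace (map M ys)) (laplace-alternating (map M ys)) p)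

  bordered-↭ : ∀ m (M : J → J → K) v {xs ys} → xs ↭ ys → bordered m M v xs ≈ bordered m M v ys
  bordered-↭ m M v {xs} {ys} p = cancel-sign p
    (trans (expand-congʳ m (v ∷ xs) (λ l _ → laplace-rows-↭ M p l)) (expand-scale m (sign p) (laplace (map M ys)) (v ∷ xs)))
    (alternating-↭ (laplace (m ∷ map M ys)) (laplace-alternating (m ∷ map M ys)) (↭.prep v p))

  -- The rows `ms` vanish on `ds`, so their expansions never consume a column of `ds`; once they are
  -- exhausted, exactly `ds` is left for `ns`. The opposite block is arbitrary.
  laplace-block : ∀ {ms ns : List (J → K)} {cs ds} → length ms ≡ length cs →
    All (λ m → All (λ d → m d ≈ 0#) ds) ms →
    laplace (ms ++ ns) (cs ++ ds) ≈ laplace ms cs * laplace ns ds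
  laplace-block {ms = []} {cs = []} e [] = sym (*-identityˡ _)
  laplace-block {ms = m ∷ ms} {ns} {cs} {ds} e (p ∷ ps) = begin
    expand m (laplace (ms ++ ns)) (cs ++ ds)          ≈⟨ expand-++ m _ cs p ⟩
    expand m (λ l → laplace (ms ++ ns) (l ++ ds)) cs
      ≈⟨ expand-congʳ m cs (λ l h → trans (laplace-block {ms = ms} {ns} {l} (ℕ.suc-injective (≡.trans e (≡.sym h))) ps) (*-comm _ _)) ⟩
    expand m (λ l → laplace ns ds * laplace ms l) cs  ≈⟨ expand-scale m _ _ cs ⟩
    laplace ns ds * expand m (laplace ms) cs          ≈⟨ *-comm _ _ ⟩
    expand m (laplace ms) cs * laplace ns ds          ∎

  Pointwise-diagonal : {P : J → Set r} {xs : List J} → All P xs → Pointwise (λ x y → x ≡ y ⊗ P x) xs xs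
  Pointwise-diagonal [] = []
  Pointwise-diagonal (p ∷ ps) = (≡.refl , p) ∷ Pointwise-diagonal ps

  Pointwise-map : {A : Set j} {P : J → J′ → Set r} {f : A → J} {g : A → J′} {xs : List A} →
    All (λ x → P (f x) (g x)) xs → Pointwise P (map f xs) (map g xs)
  Pointwise-map [] = []
  Pointwise-map (p ∷ ps) = p ∷ Pointwise-map ps

  laplace-congˡ : ∀ {ms ms′ : List (J → K)} {cs} →
    Pointwise (λ m m′ → ∀ {c} → c ∈ cs → m c ≈ m′ c) ms ms′ → laplace ms cs ≈ laplace ms′ cs
  laplace-congˡ {cs = cs} p = laplace-cong (λ x y → x ≡ y ⊗ x ∈ cs)
    (Pointwise.map (λ where q (≡.refl , h) → q h) p)
    (Pointwise-diagonal (All.tabulate id))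

  minor-cong : ∀ {M N : J → J → K} {xs} → (∀ {a b} → a ∈ xs → b ∈ xs → M a b ≈ N a b) →
    minor M xs ≈ minor N xs
  minor-cong p = laplace-congˡ (Pointwise-map (All.tabulate λ a b → p a b))

  -- This is what carries Y of H₂ from one end of the path to the other. The entry at the corner is
  -- not compared, so the different degrees of `v` and `v′` do no harm.
  offCorner-cong : ∀ {m m′} {M M′ : J → J → K} {v v′ xs} → (∀ {a} → a ∈ xs → m a ≈ m′ a) →
    (∀ {a} → a ∈ xs → M a v ≈ M′ a v′) → (∀ {a b} → a ∈ xs → b ∈ xs → M a b ≈ M′ a b) →
    offCorner m M v xs ≈ offCorner m′ M′ v′ xs
  offCorner-cong {m = m} {m′} {M} {M′} {v} {v′} {xs} p q h = -‿cong
    (expand-cong _∼_ (λ where (≡.refl , e) → p e)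
      (λ es → laplace-cong _∼′_ (Pointwise-map (All.tabulate row)) (inj₁ (≡.refl , ≡.refl) ∷ Pointwise.map inj₂ es))
      (Pointwise-diagonal (All.tabulate id)))
    where
    _∼_ = λ a b → a ≡ b ⊗ a ∈ xs
    _∼′_ = λ a b → (a ≡ v ⊗ b ≡ v′) ⊎ a ∼ b
    row : ∀ {a} → a ∈ xs → ∀ {x y} → x ∼′ y → M a x ≈ M′ a y
    row e (inj₁ (≡.refl , ≡.refl)) = q e
    row e (inj₂ (≡.refl , e′)) = h e e′

  Separated : (J → J → K) → List J → List J → Set _
  Separated M xs ys = ∀ {a b} → a ∈ xs → b ∈ ys → M a b ≈ 0# ⊗ M b a ≈ 0#

  All-map : {A : Set j} {P : J → Set r} (f : A → J) {xs : List A} → (∀ {x} → x ∈ xs → P (f x)) → All P (map f xs)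
  All-map f {[]} h = []
  All-map f {x ∷ xs} h = h (here ≡.refl) ∷ All-map f (h ∘ there)

  minor-++ : ∀ (M : J → J → K) xs ys → Separated M xs ys → minor M (xs ++ ys) ≈ minor M xs * minor M ys
  minor-++ M xs ys sep = trans (reflexive (≡.cong (λ rs → laplace rs (xs ++ ys)) (List.map-++ M xs ys)))
    (laplace-block {ms = map M xs} {map M ys} {xs} (List.length-map M xs)
      (All-map M (λ a∈ → All.tabulate λ b∈ → proj₁ (sep a∈ b∈))))

  module _ (_≟_ : DecidableEquality J) where
    open import Data.List.Membership.DecPropositional _≟_ using (_∈?_)

    -- Split the row of v into its parts on xs and off xs: each of the two resulting matrices
    -- becomes block triangular once xs or ys, respectively, is put first.
    bordered-++ : ∀ m (M : J → J → K) v {xs ys} → Separated M xs ys → v ∉ xs →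
      (∀ {b} → b ∈ ys → b ∉ xs) →
      bordered m M v (xs ++ ys) ≈ offCorner m M v xs * minor M ys + minor M xs * bordered m M v ys
    bordered-++ m M v {xs} {ys} sep v∉ dis = begin
      expand m L (v ∷ xs ++ ys)
        ≈⟨ expand-cong _≡_ (λ { {c} ≡.refl → m-split c }) (λ e → reflexive (≡.cong L (Pointwise.Pointwise-≡⇒≡ e))) (Pointwise.refl ≡.refl {v ∷ xs ++ ys}) ⟩
      expand (λ c → m₁ c + m₂ c) L (v ∷ xs ++ ys)                  ≈⟨ expand-+ m₁ m₂ L (v ∷ xs ++ ys) ⟩
      bordered m₁ M v (xs ++ ys) + bordered m₂ M v (xs ++ ys)      ≈⟨ +-congˡ (bordered-↭ m₂ M v (↭.++-comm xs ys)) ⟩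
      bordered m₁ M v (xs ++ ys) + bordered m₂ M v (ys ++ xs)      ≈⟨ +-cong block₁ block₂ ⟩
      bordered m₁ M v xs * minor M ys + bordered m₂ M v ys * minor M xs ≈⟨ +-cong (*-congʳ corner₁) (trans (*-congʳ eq₂) (*-comm _ _)) ⟩
      offCorner m M v xs * minor M ys + minor M xs * bordered m M v ys ∎
      where
      L = laplace (map M (xs ++ ys))
      -- As `v` is not in `xs`, the corner entry goes to `m₂`: the part on `xs` yields an off-corner
      -- term and the other part is again a full bordered minor, which can be split once more at
      -- `v`.
      m₁ m₂ : J → K
      m₁ c = if does (c ∈? xs) then m c else 0#
      m₂ c = if does (c ∈? xs) then 0# else m c
      m-split : ∀ c → m c ≈ m₁ c + m₂ c
      m-split c with does (c ∈? xs)
      ... | true = sym (+-identityʳ _)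
      ... | false = sym (+-identityˡ _)
      in₁ : ∀ {c} → c ∈ xs → m₁ c ≈ m c
      in₁ {c} h with c ∈? xs
      ... | yes _ = refl
      ... | no ∉ = ⊥-elim (∉ h)
      out₁ : ∀ {c} → c ∉ xs → m₁ c ≈ 0#
      out₁ {c} h with c ∈? xs
      ... | yes ∈ = ⊥-elim (h ∈)
      ... | no _ = refl
      in₂ : ∀ {c} → c ∈ xs → m₂ c ≈ 0#
      in₂ {c} h with c ∈? xs
      ... | yes _ = refl
      ... | no ∉ = ⊥-elim (∉ h)
      out₂ : ∀ {c} → c ∉ xs → m₂ c ≈ m c
      out₂ {c} h with c ∈? xs
      ... | yes ∈ = ⊥-elim (h ∈)
      ... | no _ = refl
      block : ∀ k {as bs} → Separated M as bs → All (λ b → k b ≈ 0#) bs →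
        bordered k M v (as ++ bs) ≈ bordered k M v as * minor M bs
      block k {as} {bs} sep′ z = trans
        (reflexive (≡.cong (λ rs → laplace (k ∷ rs) (v ∷ as ++ bs)) (List.map-++ M as bs)))
        (laplace-block {ms = k ∷ map M as} {map M bs} {v ∷ as} (≡.cong suc (List.length-map M as))
          (z ∷ All-map M (λ a∈ → All.tabulate λ b∈ → proj₁ (sep′ a∈ b∈))))
      block₁ = block m₁ {xs} {ys} sep (All.tabulate (out₁ ∘ dis))
      block₂ = block m₂ {ys} {xs} (λ b a → let z , w = sep a b in w , z) (All.tabulate in₂)
      corner₁ : bordered m₁ M v xs ≈ offCorner m M v xs
      corner₁ = trans (+-cong (*-congʳ (out₁ v∉)) (offCorner-cong in₁ (λ _ → refl) (λ _ _ → refl)))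
        (trans (+-congʳ (zeroˡ _)) (+-identityˡ _))
      eq₂ : bordered m₂ M v ys ≈ bordered m M v ys
      eq₂ = laplace-congˡ {ms = m₂ ∷ map M ys} {m ∷ map M ys} {v ∷ ys}
        (row ∷ Pointwise.refl (λ {r} {c} _ → refl {r c}))
        where
        row : ∀ {c} → c ∈ v ∷ ys → m₂ c ≈ m c
        row (here ≡.refl) = out₂ v∉
        row (there h) = out₂ (dis h)

    -- The splitting at `v` with the single vertex `u` as a branch: its minor is `M u u` and its
    -- off-corner part is -`M u v * M v u`.
    leaf : ∀ (M : J → J → K) {u v ys} → u ∉ v ∷ ys → (∀ {y} → y ∈ ys → M u y ≈ 0# ⊗ M y u ≈ 0#) →
      minor M (u ∷ v ∷ ys) ≈ M u u * minor M (v ∷ ys) - (M u v * M v u) * minor M ys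
    leaf M {u} {v} {ys} u∉ z = begin
      minor M (u ∷ v ∷ ys)                  ≈⟨ minor-↭ M (↭.swap u v (↭.refl {xs = ys})) ⟩
      bordered (M v) M v (u ∷ ys)
        ≈⟨ bordered-++ (M v) M v {u ∷ []} {ys} (λ where (here ≡.refl) → z)
             (λ where (here e) → u∉ (here (≡.sym e))) (λ where y∈ (here ≡.refl) → u∉ (there y∈)) ⟩
      offCorner (M v) M v (u ∷ []) * minor M ys + minor M (u ∷ []) * minor M (v ∷ ys)
        ≈⟨ solve 5 (λ a b e f g → (:- (b :* (a :* :1 :- :0) :- :0)) :* f :+ (e :* :1 :- :0) :* g :=
                                   e :* g :- (a :* b) :* f) refl (M u v) (M v u) (M u u) _ _ ⟩
      M u u * minor M (v ∷ ys) - (M u v * M v u) * minor M ys ∎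

-- Tridiagonal determinants of a path.

tabulate-last-↭ : ∀ {a} {A : Set a} {k} (φ : Fin (suc k) → A) →
  tabulate φ ↭ φ (fromℕ k) ∷ tabulate (φ ∘ inject₁)
tabulate-last-↭ {k = zero} φ = ↭.refl
tabulate-last-↭ {k = suc k} φ =
  ↭.trans (↭.prep _ (tabulate-last-↭ (φ ∘ suc))) (↭.swap _ _ ↭.refl)

module Chains {c ℓ} (R : CommutativeRing c ℓ) {j} {J : Set j} (_≟_ : DecidableEquality J) where
  open CommutativeRing R hiding (zero) renaming (Carrier to K)
  open DifferenceSolver R using (solve; _:+_; _:*_; _:-_; :-_; _:=_; :0; :1)
  open ListDeterminant R

  -- The diagonal is left free, because the ends of the path carry entries that differ from those of
  -- its interior and change under the shift. The neighbouring entries are +q since the matrix is xI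
  -- - L.
  record Chain (q : K) (M : J → J → K) {k} (φ : Fin k → J) : Set (ℓ ⊔ j) where
    field
      injective : Injective _≡_ _≡_ φ
      next : ∀ {i i′} → toℕ i′ ≡ suc (toℕ i) → M (φ i) (φ i′) ≈ q ⊗ M (φ i′) (φ i) ≈ q
      far : ∀ {i i′} → suc (toℕ i) ℕ.< toℕ i′ → M (φ i) (φ i′) ≈ 0# ⊗ M (φ i′) (φ i) ≈ 0#

  chain-suc : ∀ {q M k} {φ : Fin (suc k) → J} → Chain q M φ → Chain q M (φ ∘ suc)
  chain-suc C = record
    { injective = Fin.suc-injective ∘ injective
    ; next = next ∘ ≡.cong suc
    ; far = far ∘ s≤s
    } where open Chain C

  chain-inject₁ : ∀ {q M k} {φ : Fin (suc k) → J} → Chain q M φ → Chain q M (φ ∘ inject₁)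
  chain-inject₁ C = record
    { injective = Fin.inject₁-injective ∘ injective
    ; next = λ {i} {i′} e → next (≡.trans (Fin.toℕ-inject₁ i′) (≡.trans e (≡.cong suc (≡.sym (Fin.toℕ-inject₁ i)))))
    ; far = λ {i} {i′} → far ∘ ≡.subst₂ ℕ._<_ (≡.cong suc (≡.sym (Fin.toℕ-inject₁ i))) (≡.sym (Fin.toℕ-inject₁ i′))
    } where open Chain C

  module _ (q t : K) where

    -- inner k is the determinant of the k × k tridiagonal matrix with diagonal t and
    -- off-diagonal q, and inner⁻ k is that of size k − 1 (0 for k = 0).
    inner inner⁻ : ℕ → K
    inner zero = 1#
    inner (suc k) = t * inner k - (q * q) * inner⁻ k
    inner⁻ zero = 0#
    inner⁻ (suc k) = inner k

    -- The determinant for m interior vertices and end entries μ, ν, expanded at the start. The last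
    -- bracket `inner m - t * inner⁻ m` is -q² times `inner⁻` at m - 1 for positive m and 1 for m =
    -- 0. In this form a path of one edge needs no separate case, and no further sizes enter.
    wholePath : K → K → ℕ → K
    wholePath μ ν m = μ * (ν * inner m - (q * q) * inner⁻ m)
      - (q * q) * (ν * inner⁻ m + (inner m - t * inner⁻ m))

  module _ {q t : K} {M : J → J → K} where

    minor-leaf : ∀ {k} {φ : Fin (suc (suc k)) → J} → Chain q M φ →
      minor M (tabulate φ) ≈ M (φ zero) (φ zero) * minor M (tabulate (φ ∘ suc))
                               - (q * q) * minor M (tabulate (φ ∘ Fin.suc ∘ Fin.suc))
    minor-leaf {φ = φ} C = trans
      (leaf _≟_ M (λ h → φ0∉ (∈-tabulate⁻ {f = φ ∘ suc} h)) far0)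
      (minus-cong refl (*-congʳ (*-cong (proj₁ (next {zero} {suc zero} ≡.refl)) (proj₂ (next {zero} {suc zero} ≡.refl)))))
      where
      open Chain C
      φ0∉ : ¬ ∃ (λ i → φ zero ≡ φ (suc i))
      φ0∉ (i , e) with () ← injective e
      far0 : ∀ {y} → y ∈ tabulate (φ ∘ Fin.suc ∘ Fin.suc) → M (φ zero) y ≈ 0# ⊗ M y (φ zero) ≈ 0#
      far0 h with i , ≡.refl ← ∈-tabulate⁻ {f = φ ∘ Fin.suc ∘ Fin.suc} h = far {zero} {suc (suc i)} (s≤s (s≤s z≤n))

    minor-tail : ∀ {k ν} {φ : Fin (suc k) → J} → Chain q M φ →
      (∀ i → M (φ (inject₁ i)) (φ (inject₁ i)) ≈ t) → M (φ (fromℕ k)) (φ (fromℕ k)) ≈ ν →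
      minor M (tabulate φ) ≈ ν * inner q t k - (q * q) * inner⁻ q t k
    minor-tail {zero} {ν} C h e = trans (+-congʳ (*-congʳ e))
      (solve 2 (λ ν q → ν :* :1 :- :0 := ν :* :1 :- (q :* q) :* :0) refl ν q)
    minor-tail {suc zero} {ν} C h e = trans (minor-leaf C)
      (trans (minus-cong (*-cong (h zero) (minor-tail (chain-suc C) (h ∘ suc) e)) refl)
        (solve 3 (λ ν q t → t :* (ν :* :1 :- (q :* q) :* :0) :- (q :* q) :* :1 :=
                            ν :* (t :* :1 :- (q :* q) :* :0) :- (q :* q) :* :1) refl ν q t))
    minor-tail {suc (suc k)} {ν} C h e = trans (minor-leaf C)
      (trans (minus-cong (*-cong (h zero) (minor-tail (chain-suc C) (h ∘ suc) e))
                         (*-congˡ (minor-tail (chain-suc (chain-suc C)) (h ∘ Fin.suc ∘ Fin.suc) e)))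
        (solve 5 (λ ν q t a b → t :* (ν :* (t :* a :- (q :* q) :* b) :- (q :* q) :* a)
                                  :- (q :* q) :* (ν :* a :- (q :* q) :* b) :=
                                ν :* (t :* (t :* a :- (q :* q) :* b) :- (q :* q) :* a)
                                  :- (q :* q) :* (t :* a :- (q :* q) :* b)) refl
           ν q t (inner q t k) (inner⁻ q t k)))

    minor-inner : ∀ {k} {φ : Fin k → J} → Chain q M φ → (∀ i → M (φ i) (φ i) ≈ t) →
      minor M (tabulate φ) ≈ inner q t k
    minor-inner {zero} C h = refl
    minor-inner {suc k} C h = minor-tail C (h ∘ inject₁) (h (fromℕ k))

    minor-head : ∀ {k} {φ : Fin (suc k) → J} → Chain q M φ → (∀ i → M (φ (suc i)) (φ (suc i)) ≈ t) →
      minor M (tabulate φ) ≈ M (φ zero) (φ zero) * inner q t k - (q * q) * inner⁻ q t k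
    minor-head {zero} C h = minor-tail C (λ ()) refl
    minor-head {suc k} C h = trans (minor-leaf C)
      (minus-cong (*-congˡ (minor-inner (chain-suc C) h)) (*-congˡ (minor-inner (chain-suc (chain-suc C)) (h ∘ suc))))

    minor-tail⁻ : ∀ {k ν} {φ : Fin (suc k) → J} → Chain q M φ →
      (∀ i → M (φ (inject₁ i)) (φ (inject₁ i)) ≈ t) → M (φ (fromℕ k)) (φ (fromℕ k)) ≈ ν →
      minor M (tabulate (φ ∘ suc)) ≈ ν * inner⁻ q t k + (inner q t k - t * inner⁻ q t k)
    minor-tail⁻ {zero} {ν} C h e = solve 2 (λ ν t → :1 := ν :* :0 :+ (:1 :- t :* :0)) refl ν t
    minor-tail⁻ {suc k} {ν} C h e = trans (minor-tail (chain-suc C) (h ∘ suc) e)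
      (solve 5 (λ ν q t a b → ν :* a :- (q :* q) :* b :=
                              ν :* a :+ (t :* a :- (q :* q) :* b :- t :* a)) refl ν q t (inner q t k) (inner⁻ q t k))

    minor-path : ∀ {m ν} {φ : Fin (suc (suc m)) → J} → Chain q M φ →
      (∀ i → M (φ (suc (inject₁ i))) (φ (suc (inject₁ i))) ≈ t) →
      M (φ (fromℕ (suc m))) (φ (fromℕ (suc m))) ≈ ν →
      minor M (tabulate φ) ≈ wholePath q t (M (φ zero) (φ zero)) ν m
    minor-path C h e = trans (minor-leaf C)
      (minus-cong (*-congˡ (minor-tail (chain-suc C) h e)) (*-congˡ (minor-tail⁻ (chain-suc C) h e)))

-- The minors of the two trees, cut at the ends of the path.

module Shift {c ℓ} (R : CommutativeRing c ℓ) {j} {J : Set j} (_≟_ : DecidableEquality J) where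
  open CommutativeRing R hiding (zero) renaming (Carrier to K)
  open DifferenceSolver R using (solve; _:+_; _:*_; _:-_; :-_; _:=_; :0; :1)
  open ListDeterminant R
  open Chains R _≟_
  open import Relation.Binary.Reasoning.Setoid setoid

  module _ {q t μ ν : K} {M : J → J → K} {m} {φ : Fin (suc (suc m)) → J} (C : Chain q M φ)
    (diagonal : ∀ i → M (φ (suc (inject₁ i))) (φ (suc (inject₁ i))) ≈ t)
    (μ-eq : M (φ zero) (φ zero) ≈ μ) (ν-eq : M (φ (fromℕ (suc m))) (φ (fromℕ (suc m))) ≈ ν)
    where

    private
      s = φ zero
      e = φ (fromℕ (suc m))
      Q = tabulate (φ ∘ Fin.suc ∘ inject₁)
      E = inner q t m
      E⁻ = inner⁻ q t m

    minor-interior : minor M Q ≈ E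
    minor-interior = minor-inner (chain-inject₁ (chain-suc C)) diagonal

    minor-end : minor M (e ∷ Q) ≈ ν * E - (q * q) * E⁻
    minor-end = trans (minor-↭ M (↭.↭-sym (tabulate-last-↭ (φ ∘ suc)))) (minor-tail (chain-suc C) diagonal ν-eq)

    minor-start : minor M (s ∷ Q) ≈ μ * E - (q * q) * E⁻
    minor-start = trans (minor-head (chain-inject₁ C) diagonal) (minus-cong (*-congʳ μ-eq) refl)

    minor-both : minor M (s ∷ e ∷ Q) ≈ wholePath q t μ ν m
    minor-both = trans (minor-↭ M (↭.prep s (↭.↭-sym (tabulate-last-↭ (φ ∘ suc)))))
      (trans (minor-path C diagonal ν-eq) (minus-cong (*-congʳ μ-eq) refl))

    module _ {A₁ A₂ : List J} (s∉A₁ : s ∉ A₁) (disjoint : ∀ {b} → b ∈ e ∷ Q ++ A₂ → b ∉ A₁) where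

      -- The cut at `s` leaves two minors that still contain `e`, one without `s` and one with it.
      -- Cutting both at `e` yields the four pieces of the path: the interior alone, with either
      -- end, and with both.
      minor-split : e ∉ A₂ → (∀ {b} → b ∈ s ∷ Q → b ∉ A₂) →
        Separated M A₁ (e ∷ Q ++ A₂) → Separated M A₂ (s ∷ Q) →
        let D₁ = minor M A₁ ; D₂ = minor M A₂
            Y₁ = offCorner (M s) M s A₁ ; Y₂ = offCorner (M e) M e A₂ in
        minor M (s ∷ A₁ ++ (e ∷ Q ++ A₂)) ≈
          Y₁ * (Y₂ * E + D₂ * (ν * E - (q * q) * E⁻)) +
          D₁ * (Y₂ * (μ * E - (q * q) * E⁻) + D₂ * wholePath q t μ ν m)
      minor-split e∉A₂ disjoint₂ sep₁ sep₂ = begin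
        minor M (s ∷ A₁ ++ (e ∷ Q ++ A₂))
          ≈⟨ bordered-++ _≟_ (M s) M s sep₁ s∉A₁ disjoint ⟩
        Y₁ * minor M (e ∷ Q ++ A₂) + D₁ * minor M (s ∷ e ∷ Q ++ A₂)
          ≈⟨ +-cong (*-congˡ (minor-↭ M (↭.prep e (↭.++-comm Q A₂))))
                    (*-congˡ (minor-↭ M (↭.trans (↭.swap s e ↭.refl) (↭.prep e (↭.++-comm (s ∷ Q) A₂))))) ⟩
        Y₁ * minor M (e ∷ A₂ ++ Q) + D₁ * minor M (e ∷ A₂ ++ (s ∷ Q))
          ≈⟨ +-cong (*-congˡ (bordered-++ _≟_ (M e) M e (λ a b → sep₂ a (there b)) e∉A₂ (disjoint₂ ∘ there)))
                    (*-congˡ (bordered-++ _≟_ (M e) M e sep₂ e∉A₂ disjoint₂)) ⟩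
        Y₁ * (Y₂ * minor M Q + D₂ * minor M (e ∷ Q)) + D₁ * (Y₂ * minor M (s ∷ Q) + D₂ * minor M (e ∷ s ∷ Q))
          ≈⟨ +-cong (*-congˡ (+-cong (*-congˡ minor-interior) (*-congˡ minor-end)))
                    (*-congˡ (+-cong (*-congˡ minor-start)
                      (*-congˡ (trans (minor-↭ M (↭.swap e s (↭.refl {xs = Q}))) minor-both)))) ⟩
        Y₁ * (Y₂ * E + D₂ * (ν * E - (q * q) * E⁻)) +
          D₁ * (Y₂ * (μ * E - (q * q) * E⁻) + D₂ * wholePath q t μ ν m) ∎
        where
        D₁ = minor M A₁ ; D₂ = minor M A₂
        Y₁ = offCorner (M s) M s A₁ ; Y₂ = offCorner (M e) M e A₂

      -- With `A₂` hanging at `s`, removing `s` detaches it from the path, so the first summand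
      -- factors outright. In the second summand `s` is still present and is cut a second time.
      minor-join : s ∉ A₂ → (∀ {b} → b ∈ e ∷ Q → b ∉ A₂) →
        Separated M A₁ (e ∷ Q ++ A₂) → Separated M A₂ (e ∷ Q) →
        let D₁ = minor M A₁ ; D₂ = minor M A₂
            Y₁ = offCorner (M s) M s A₁ ; Y₂ = offCorner (M s) M s A₂
            P = ν * E - (q * q) * E⁻ in
        minor M (s ∷ A₁ ++ (e ∷ Q ++ A₂)) ≈
          Y₁ * (D₂ * P) + D₁ * (Y₂ * P + D₂ * wholePath q t μ ν m)
      minor-join s∉A₂ disjoint₂ sep₁ sep₂ = begin
        minor M (s ∷ A₁ ++ (e ∷ Q ++ A₂))
          ≈⟨ bordered-++ _≟_ (M s) M s sep₁ s∉A₁ disjoint ⟩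
        Y₁ * minor M (e ∷ Q ++ A₂) + D₁ * minor M (s ∷ e ∷ Q ++ A₂)
          ≈⟨ +-cong (*-congˡ (minor-↭ M (↭.++-comm (e ∷ Q) A₂)))
                    (*-congˡ (minor-↭ M (↭.prep s (↭.++-comm (e ∷ Q) A₂)))) ⟩
        Y₁ * minor M (A₂ ++ (e ∷ Q)) + D₁ * minor M (s ∷ A₂ ++ (e ∷ Q))
          ≈⟨ +-cong (*-congˡ (minor-++ M A₂ (e ∷ Q) sep₂))
                    (*-congˡ (bordered-++ _≟_ (M s) M s sep₂ s∉A₂ disjoint₂)) ⟩
        Y₁ * (D₂ * minor M (e ∷ Q)) + D₁ * (Y₂ * minor M (e ∷ Q) + D₂ * minor M (s ∷ e ∷ Q))
          ≈⟨ +-cong (*-congˡ (*-congˡ minor-end))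
                    (*-congˡ (+-cong (*-congˡ minor-end) (*-congˡ minor-both))) ⟩
        Y₁ * (D₂ * (ν * E - (q * q) * E⁻)) + D₁ * (Y₂ * (ν * E - (q * q) * E⁻) + D₂ * wholePath q t μ ν m) ∎
        where
        D₁ = minor M A₁ ; D₂ = minor M A₂
        Y₁ = offCorner (M s) M s A₁ ; Y₂ = offCorner (M s) M s A₂

  diagonalEntry : K → K → K → K
  diagonalEntry q x d = x - (1# + (q * q) * (d - 1#))

  -- d₁ and d₂ are the degrees of the two ends of the path off the path.
  shift-identity : ∀ q x d₁ d₂ D₁ D₂ Y₁ Y₂ m →
    let δ = diagonalEntry q x
        t = δ (1# + 1#)
        E = inner q t m
        E⁻ = inner⁻ q t m
        c = x + q * q - 1#
        P = δ 1# * E - (q * q) * E⁻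
    in
    ((q * q) * x) *
      ( (Y₁ * (Y₂ * E + D₂ * (δ (d₂ + 1#) * E - (q * q) * E⁻)) +
         D₁ * (Y₂ * (δ (d₁ + 1#) * E - (q * q) * E⁻) + D₂ * wholePath q t (δ (d₁ + 1#)) (δ (d₂ + 1#)) m))
      - (Y₁ * (D₂ * P) + D₁ * (Y₂ * P + D₂ * wholePath q t (δ (d₁ + 1# + d₂)) (δ 1#) m)))
    ≈ - (((wholePath q t (δ 1#) (δ 1#) m - c * P)
         * ((δ d₁ * D₁ + Y₁) - c * D₁))
         * ((δ d₂ * D₂ + Y₂) - c * D₂))
  shift-identity q x d₁ d₂ D₁ D₂ Y₁ Y₂ m =
    solve 10 (λ q x d₁ d₂ D₁ D₂ Y₁ Y₂ E E⁻ →
      let δ = λ d → x :- (:1 :+ (q :* q) :* (d :- :1))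
          t = δ (:1 :+ :1)
          c = x :+ q :* q :- :1
          P = δ :1 :* E :- (q :* q) :* E⁻
          whole = λ μ ν → μ :* (ν :* E :- (q :* q) :* E⁻) :- (q :* q) :* (ν :* E⁻ :+ (E :- t :* E⁻))
      in
      ((q :* q) :* x) :*
        ( (Y₁ :* (Y₂ :* E :+ D₂ :* (δ (d₂ :+ :1) :* E :- (q :* q) :* E⁻)) :+
           D₁ :* (Y₂ :* (δ (d₁ :+ :1) :* E :- (q :* q) :* E⁻) :+ D₂ :* whole (δ (d₁ :+ :1)) (δ (d₂ :+ :1))))
        :- (Y₁ :* (D₂ :* P) :+ D₁ :* (Y₂ :* P :+ D₂ :* whole (δ (d₁ :+ :1 :+ d₂)) (δ :1))))
      := :- (((whole (δ :1) (δ :1) :- c :* P)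
           :* ((δ d₁ :* D₁ :+ Y₁) :- c :* D₁))
           :* ((δ d₂ :* D₂ :+ Y₂) :- c :* D₂))) refl
      q x d₁ d₂ D₁ D₂ Y₁ Y₂ (inner q (diagonalEntry q x (1# + 1#)) m) (inner⁻ q (diagonalEntry q x (1# + 1#)) m)

-- From the recursive determinant to the expansion along lists.

module FieldDeterminant {c ℓ₁ ℓ₂} (F : HeytingField c ℓ₁ ℓ₂) where
  open WithField F
  R = HeytingCommutativeRing.commutativeRing (HeytingField.heytingCommutativeRing F)
  open CommutativeRing R hiding (zero) renaming (Carrier to K)
  open import Algebra.Properties.Ring ring
  open ListDeterminant R
  open import Relation.Binary.Reasoning.Setoid setoid

  alternate : ℕ → K → K
  alternate zero a = a
  alternate (suc zero) a = - a
  alternate (suc (suc k)) a = alternate k a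

  -- The sign function inside `det` has no accessible name; it is identified by its three defining
  -- equations, which hold for it by computation.
  alternate-unique : (s : ℕ → K → K) → (∀ a → s 0 a ≡ a) → (∀ a → s 1 a ≡ - a) →
    (∀ k a → s (suc (suc k)) a ≡ s k a) → ∀ k a → s k a ≡ alternate k a
  alternate-unique s p q r zero a = p a
  alternate-unique s p q r (suc zero) a = q a
  alternate-unique s p q r (suc (suc k)) a = ≡.trans (r k a) (alternate-unique s p q r k a)

  alternate-cong : ∀ k {a b} → a ≈ b → alternate k a ≈ alternate k b
  alternate-cong zero e = e
  alternate-cong (suc zero) e = -‿cong e
  alternate-cong (suc (suc k)) e = alternate-cong k e

  alternate-suc : ∀ k a → alternate (suc k) a ≈ - alternate k a
  alternate-suc zero a = refl
  alternate-suc (suc zero) a = sym (-‿involutive a)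
  alternate-suc (suc (suc k)) a = alternate-suc k a

  -- The sign and the summand in the definition of det are local there; they are recovered
  -- here by unification.
  module _ (m : ℕ) (M : Fin (suc m) → Fin (suc m) → K) where
    mutual
      summand : Fin (suc m) → K
      summand = _

      det-suc : det (suc m) M ≡ sumK (List.map summand (allFin (suc m)))
      det-suc = ≡.refl

      signOf : ℕ → K → K
      signOf = _

      summand-alternate : ∀ j → summand j ≡ alternate (toℕ j) (M zero j * det m (λ i k → M (suc i) (punchIn j k)))
      -- Abstracting both arguments turns the goal into the local sign applied to variables, and
      -- this is what lets unification determine `signOf`.
      summand-alternate j with toℕ j | M zero j * det m (λ i k → M (suc i) (punchIn j k))
      ... | k | a = alternate-unique signOf (λ _ → ≡.refl) (λ _ → ≡.refl) (λ _ _ → ≡.refl) k a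

  sumK-tabulate-cong : ∀ {k} {f g : Fin k → K} → (∀ j → f j ≈ g j) → sumK (tabulate f) ≈ sumK (tabulate g)
  sumK-tabulate-cong {zero} h = refl
  sumK-tabulate-cong {suc k} h = +-cong (h zero) (sumK-tabulate-cong (h ∘ suc))

  sumK-tabulate-neg : ∀ {k} (f : Fin k → K) → sumK (tabulate (λ j → - f j)) ≈ - sumK (tabulate f)
  sumK-tabulate-neg {zero} f = sym -0#≈0#
  sumK-tabulate-neg {suc k} f = trans (+-congˡ (sumK-tabulate-neg (f ∘ suc))) (-‿+-comm _ _)

  expand-tabulate : ∀ {j} {J : Set j} k m (f : List J → K) (γ : Fin (suc k) → J) →
    expand m f (tabulate γ) ≈
      sumK (tabulate λ j → alternate (toℕ j) (m (γ j) * f (tabulate (γ ∘ punchIn j))))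
  expand-tabulate zero m f γ = +-congˡ -0#≈0#
  expand-tabulate (suc k) m f γ = +-congˡ (begin
    - expand m (λ l → f (γ zero ∷ l)) (tabulate (γ ∘ suc))
      ≈⟨ -‿cong (expand-tabulate k m (λ l → f (γ zero ∷ l)) (γ ∘ suc)) ⟩
    - sumK (tabulate g)
      ≈⟨ sumK-tabulate-neg g ⟨
    sumK (tabulate λ j → - g j)
      ≈⟨ sumK-tabulate-cong {f = λ j → - g j} (λ j → sym (alternate-suc (toℕ j) (m (γ (suc j)) * f (tabulate (γ ∘ punchIn (suc j)))))) ⟩
    sumK (tabulate λ j → alternate (suc (toℕ j)) (m (γ (suc j)) * f (tabulate (γ ∘ punchIn (suc j))))) ∎)
    where
    g : Fin (suc k) → K
    g j = alternate (toℕ j) (m (γ (suc j)) * f (tabulate (γ ∘ punchIn (suc j))))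

  -- Rows and columns are indexed separately, since each expansion removes the first row but an
  -- arbitrary column.
  det-laplace : ∀ {j} {J : Set j} k (N : Fin k → J → K) (γ : Fin k → J) →
    det k (λ i l → N i (γ l)) ≈ laplace (tabulate N) (tabulate γ)
  det-laplace zero N γ = refl
  det-laplace (suc k) N γ = begin
    det (suc k) M                                    ≡⟨ det-suc k M ⟩
    sumK (List.map (summand k M) (allFin (suc k)))   ≡⟨ ≡.cong sumK (List.map-tabulate id (summand k M)) ⟩
    sumK (tabulate (summand k M))
      ≈⟨ sumK-tabulate-cong (λ j → trans (reflexive (summand-alternate k M j))
           (alternate-cong (toℕ j) (*-congˡ (det-laplace k (N ∘ suc) (γ ∘ punchIn j))))) ⟩
    sumK (tabulate λ j → alternate (toℕ j) (N zero (γ j) * laplace (tabulate (N ∘ suc)) (tabulate (γ ∘ punchIn j))))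
      ≈⟨ expand-tabulate k (N zero) (laplace (tabulate (N ∘ suc))) γ ⟨
    expand (N zero) (laplace (tabulate (N ∘ suc))) (tabulate γ) ∎
    where
    M = λ i l → N i (γ l)

  detOn-minor : ∀ {n} (S : Fin n → Bool) (M : Fin n → Fin n → K) →
    detOn S M ≈ minor M (filter (λ v → S v ≟ true) (allFin n))
  detOn-minor {n} S M = trans (det-laplace _ (M ∘ List.lookup vs) (List.lookup vs))
    (reflexive (≡.cong₂ laplace
      (≡.trans (≡.sym (List.map-tabulate (List.lookup vs) M)) (≡.cong (List.map M) (List.tabulate-lookup vs)))
      (List.tabulate-lookup vs)))
    where
    vs = filter (λ v → S v ≟ true) (allFin n)

-- Edge counting in connected graphs.

module Graphs where
  open ≡ using (refl; sym; trans; cong; cong₂; subst)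
  open import Data.Product using (_×_)

  private variable
    n : ℕ

  bit : Bool → ℕ
  bit true = 1
  bit false = 0

  Σ[_] : ∀ {a} {A : Set a} → List A → (A → ℕ) → ℕ
  Σ[ xs ] f = sum (map f xs)

  module _ {a} {A : Set a} where

    Σ-cong : ∀ xs {f g : A → ℕ} → (∀ x → f x ≡ g x) → Σ[ xs ] f ≡ Σ[ xs ] g
    Σ-cong xs h = cong sum (List.map-cong h xs)

    Σ-≤ : ∀ xs {f g : A → ℕ} → (∀ x → f x ≤ g x) → Σ[ xs ] f ≤ Σ[ xs ] g
    Σ-≤ [] h = z≤n
    Σ-≤ (x ∷ xs) h = ℕ.+-mono-≤ (h x) (Σ-≤ xs h)

    Σ-+ : ∀ xs (f g : A → ℕ) → Σ[ xs ] (λ x → f x ℕ.+ g x) ≡ Σ[ xs ] f ℕ.+ Σ[ xs ] g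
    Σ-+ [] f g = refl
    Σ-+ (x ∷ xs) f g = trans (cong (f x ℕ.+ g x ℕ.+_) (Σ-+ xs f g))
      (solve 4 (λ a b c d → a :+ b :+ (c :+ d) := a :+ c :+ (b :+ d)) refl (f x) (g x) _ _)
      where open +-*-Solver

    Σ-↭ : ∀ {xs ys} → xs ↭ ys → (f : A → ℕ) → Σ[ xs ] f ≡ Σ[ ys ] f
    Σ-↭ p f = sum-↭ (↭.map⁺ f p)

    Σ-member : ∀ {xs x} (f : A → ℕ) → x ∈ xs → f x ≤ Σ[ xs ] f
    Σ-member f (here refl) = ℕ.m≤m+n _ _
    Σ-member f (there h) = ℕ.≤-trans (Σ-member f h) (ℕ.m≤n+m _ _)

    Unique-++-disjoint : ∀ {xs ys : List A} → Unique (xs ++ ys) → ∀ {v} → v ∈ xs → v ∉ ys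
    Unique-++-disjoint {x ∷ xs} u (here refl) h = Unique.Unique[x∷xs]⇒x∉xs u (∈-++⁺ʳ xs h)
    Unique-++-disjoint {x ∷ xs} (_ ∷ u) (there v∈) h = Unique-++-disjoint u v∈ h

  countTrue-Σ : ∀ {a} {A : Set a} (g : A → Bool) xs → countTrue (map g xs) ≡ Σ[ xs ] (bit ∘ g)
  countTrue-Σ g [] = refl
  countTrue-Σ g (x ∷ xs) with g x
  ... | true = cong suc (countTrue-Σ g xs)
  ... | false = countTrue-Σ g xs

  count : (Fin n → Bool) → ℕ
  count g = Σ[ allFin _ ] (bit ∘ g)

  count-cong : {g h : Fin n → Bool} → (∀ v → g v ≡ h v) → count g ≡ count h
  count-cong e = Σ-cong (allFin _) (cong bit ∘ e)

  deg-count : (G : Graph n) → ∀ v → deg G v ≡ count (G v)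
  deg-count G v = countTrue-Σ (G v) (allFin _)

  Σ-zero : ∀ {a} {A : Set a} (xs : List A) → Σ[ xs ] (λ _ → 0) ≡ 0
  Σ-zero [] = refl
  Σ-zero (x ∷ xs) = Σ-zero xs

  Σ-allFin-suc : (f : Fin (suc n) → ℕ) → Σ[ allFin (suc n) ] f ≡ f zero ℕ.+ Σ[ allFin n ] (f ∘ suc)
  Σ-allFin-suc f = cong (λ l → f zero ℕ.+ sum l)
    (trans (List.map-tabulate suc f) (sym (List.map-tabulate id (f ∘ suc))))

  Σ-single : (w : Fin n) → (f : Fin n → ℕ) → (∀ v → v ≢ w → f v ≡ 0) → Σ[ allFin n ] f ≡ f w
  Σ-single {suc n} zero f h = trans (Σ-allFin-suc f)
    (trans (cong (f zero ℕ.+_) (trans (Σ-cong (allFin _) (λ v → h (suc v) (λ ()))) (Σ-zero (allFin n)))) (ℕ.+-identityʳ _))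
  Σ-single (suc w) f h = trans (Σ-allFin-suc f)
    (trans (cong (ℕ._+ Σ[ allFin _ ] (f ∘ suc)) (h zero (λ ()))) (Σ-single w (f ∘ suc) (λ v ne → h (suc v) (ne ∘ Fin.suc-injective))))

  ==-refl : (a : Fin n) → (a == a) ≡ true
  ==-refl a with a Fin.≟ a
  ... | yes _ = refl
  ... | no ne = ⊥-elim (ne refl)

  ==-false : {a b : Fin n} → a ≢ b → (a == b) ≡ false
  ==-false {a = a} {b} ne with a Fin.≟ b
  ... | yes e = ⊥-elim (ne e)
  ... | no _ = refl

  ==-true : {a b : Fin n} → (a == b) ≡ true → a ≡ b
  ==-true {a = a} {b} h with yes e ← a Fin.≟ b = e

  count-single : {g : Fin n → Bool} (w : Fin n) → g w ≡ true → (∀ v → g v ≡ true → v ≡ w) → count g ≡ 1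
  count-single {g = g} w h u = trans (Σ-single w (bit ∘ g) off) (cong bit h)
    where
    off : ∀ v → v ≢ w → bit (g v) ≡ 0
    off v ne with g v in e
    ... | true = ⊥-elim (ne (u v e))
    ... | false = refl

  bool-ext : ∀ {a b} → (a ≡ true → b ≡ true) → (b ≡ true → a ≡ true) → a ≡ b
  bool-ext {true} f g = sym (f refl)
  bool-ext {false} {true} f g = g refl
  bool-ext {false} {false} f g = refl

  ≢true : ∀ {b} → b ≢ true → b ≡ false
  ≢true = Bool.¬-not

  ∧-true⁻ : ∀ {a b} → a ∧ b ≡ true → a ≡ true × b ≡ true
  ∧-true⁻ {true} {true} h = refl , refl

  ∨-true⁻ : ∀ {a b} → a ∨ b ≡ true → a ≡ true ⊎ b ≡ true
  ∨-true⁻ {true} h = inj₁ refl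
  ∨-true⁻ {false} h = inj₂ h

  module _ {G : Graph n} where

    _◅◅_ : ∀ {a b c} → Walk G a b → Walk G b c → Walk G a c
    here ◅◅ w = w
    step e v ◅◅ w = step e (v ◅◅ w)

    reverse : (∀ a b → G a b ≡ G b a) → ∀ {a b} → Walk G a b → Walk G b a
    reverse sm here = here
    reverse sm (step e w) = reverse sm w ◅◅ step (trans (sm _ _) e) here

    crossing : ∀ xs {a b} → a ∈ xs → b ∉ xs → Walk G a b →
      ∃[ u ] ∃[ v ] u ∈ xs × v ∉ xs × G u v ≡ true
    crossing xs a∈ b∉ here = ⊥-elim (b∉ a∈)
    crossing xs {a} a∈ b∉ (step {v = c} e w) with c ∈? xs
      where open import Data.List.Membership.DecPropositional (Fin._≟_ {n}) using (_∈?_)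
    ... | yes c∈ = crossing xs c∈ b∉ w
    ... | no c∉ = a , c , a∈ , c∉ , e

  entries : Graph n → List (Fin n) → ℕ
  entries G xs = Σ[ xs ] λ a → Σ[ xs ] λ b → bit (G a b)

  entries-↭ : (G : Graph n) → ∀ {xs ys} → xs ↭ ys → entries G xs ≡ entries G ys
  entries-↭ G {xs} p = trans (Σ-cong xs (λ a → Σ-↭ p _)) (Σ-↭ p _)

  -- The edge between `a` and `b` is counted twice among ordered pairs, once in the row of `b` and
  -- once in its column.
  entries-∷ : (G : Graph n) → (∀ a b → G a b ≡ G b a) → ∀ {a b xs} → a ∈ xs → G a b ≡ true →
    2 ℕ.+ entries G xs ≤ entries G (b ∷ xs)
  entries-∷ G sm {a} {b} {xs} a∈ e = begin
    2 ℕ.+ entries G xs                  ≡⟨⟩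
    1 ℕ.+ (1 ℕ.+ entries G xs)          ≤⟨ ℕ.+-mono-≤ col (ℕ.+-monoˡ-≤ _ row) ⟩
    C ℕ.+ (Rw ℕ.+ entries G xs)         ≡⟨ solve 3 (λ c r e → c :+ (r :+ e) := r :+ (c :+ e)) refl C Rw (entries G xs) ⟩
    Rw ℕ.+ (C ℕ.+ entries G xs)         ≡⟨ cong (Rw ℕ.+_) (Σ-+ xs (λ c → bit (G c b)) _) ⟨
    Rw ℕ.+ (Σ[ xs ] λ c → Σ[ b ∷ xs ] λ d → bit (G c d))
      ≤⟨ ℕ.+-monoˡ-≤ _ (ℕ.m≤n+m Rw (bit (G b b))) ⟩
    entries G (b ∷ xs)                  ∎
    where
    open ℕ.≤-Reasoning
    open +-*-Solver
    C = Σ[ xs ] λ c → bit (G c b)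
    Rw = Σ[ xs ] λ d → bit (G b d)
    col : 1 ≤ C
    col = subst (_≤ C) (cong bit e) (Σ-member (λ c → bit (G c b)) a∈)
    row : 1 ≤ Rw
    row = subst (_≤ Rw) (cong bit (trans (sm b a) e)) (Σ-member (λ d → bit (G b d)) a∈)

  -- Vertices are moved from ys to xs one at a time along an edge leaving xs.
  connected-entries : (G : Graph n) → (∀ a b → G a b ≡ G b a) → (∀ a b → Walk G a b) →
    ∀ k {x xs ys} → length ys ≡ k → allFin n ↭ (x ∷ xs) ++ ys →
    2 ℕ.* k ℕ.+ entries G (x ∷ xs) ≤ entries G (allFin n)
  connected-entries G sm conn zero {x} {xs} {[]} refl p =
    ℕ.≤-reflexive (trans (cong (entries G) (sym (List.++-identityʳ (x ∷ xs)))) (sym (entries-↭ G p)))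
  connected-entries {n} G sm conn (suc k) {x} {xs} {y ∷ ys} e p
    with a , b , a∈ , b∉ , ab ← crossing (x ∷ xs) (here refl)
           (λ h → Unique-++-disjoint (↭ₛ.Unique-resp-↭ (≡.setoid _) (↭.↭⇒↭ₛ p) (Unique.allFin⁺ n)) h (here refl)) (conn x y)
    with ∈-++⁻ (x ∷ xs) (↭.∈-resp-↭ p (∈-allFin b))
  ... | inj₁ b∈ = ⊥-elim (b∉ b∈)
  ... | inj₂ b∈ with us , vs , eq ← ∈-∃++ b∈ = begin
    2 ℕ.* suc k ℕ.+ entries G (x ∷ xs)        ≡⟨ solve 2 (λ k e → con 2 :* (con 1 :+ k) :+ e := con 2 :* k :+ (con 2 :+ e)) refl k _ ⟩
    2 ℕ.* k ℕ.+ (2 ℕ.+ entries G (x ∷ xs))    ≤⟨ ℕ.+-monoʳ-≤ (2 ℕ.* k) (entries-∷ G sm a∈ ab) ⟩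
    2 ℕ.* k ℕ.+ entries G (b ∷ x ∷ xs)
      ≤⟨ connected-entries G sm conn k {b} {x ∷ xs} {us ++ vs} (ℕ.suc-injective (trans (sym (↭.↭-length q)) e)) r ⟩
    entries G (allFin n)                      ∎
    where
    open ℕ.≤-Reasoning
    open +-*-Solver
    q : y ∷ ys ↭ b ∷ us ++ vs
    q = subst (_↭ b ∷ us ++ vs) (sym eq) (↭.shift b us vs)
    r : allFin n ↭ (b ∷ x ∷ xs) ++ (us ++ vs)
    r = ↭.trans p (↭.trans (↭.++⁺ˡ (x ∷ xs) q) (↭.shift b (x ∷ xs) (us ++ vs)))

  -- Ordered pairs are counted, so this is the bound of at least n - 1 edges. It is compared in
  -- `no-bypass` with `edgeCount`, which is also twice the number of edges.
  connected⇒entries≥ : (G : Graph n) → (∀ a b → G a b ≡ G b a) → (∀ a b → Walk G a b) →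
    2 ℕ.* (n ℕ.∸ 1) ≤ entries G (allFin n)
  connected⇒entries≥ {zero} G sm conn = z≤n
  connected⇒entries≥ {suc n} G sm conn = ℕ.≤-trans (ℕ.m≤m+n _ _)
    (connected-entries G sm conn n {zero} {[]} (List.length-tabulate _) ↭.refl)

  does-true : ∀ {p} {P : Set p} (d : Dec P) → does d ≡ true → P
  does-true (yes p) _ = p

  true-does : ∀ {p} {P : Set p} (d : Dec P) → P → does d ≡ true
  true-does (yes _) _ = refl
  true-does (no ¬p) p = ⊥-elim (¬p p)

  data Position {m} : Fin (suc (suc m)) → Set where
    first  : Position zero
    inside : ∀ i → Position (suc (inject₁ i))
    last   : Position (fromℕ (suc m))

  position : ∀ {m} (i : Fin (suc (suc m))) → Position i
  position zero = first
  position (suc i) with view i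
  ... | ‵fromℕ = last
  ... | ‵inject₁ j = inside j

  fromℕ≢inject₁ : ∀ {k} {i : Fin k} → fromℕ k ≢ inject₁ i
  fromℕ≢inject₁ {suc k} {suc i} e = fromℕ≢inject₁ (Fin.suc-injective e)

  inject₁²≢suc² : ∀ {k} (i : Fin k) → inject₁ (inject₁ i) ≢ suc (suc i)
  inject₁²≢suc² (suc i) e = inject₁²≢suc² i (Fin.suc-injective e)

  -- The path inside the tree.

  module PathInTree {n} {T : Graph n} (tree : IsTree T) {m} (P : Path T m) (deg2 : Path.InternalDeg2 P) where
    open IsTree tree
    open Path P public

    N PE : Graph n
    N = minusPath
    PE = pathEdge

    internal : Fin m → Fin n
    internal i = vtx (suc (inject₁ i))

    Consecutive : Fin n → Fin n → Set
    Consecutive a b = ∃[ i ] ((vtx (inject₁ i) ≡ a × vtx (suc i) ≡ b) ⊎ (vtx (inject₁ i) ≡ b × vtx (suc i) ≡ a))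

    edge⇒consecutive : ∀ {a b} → PE a b ≡ true → Consecutive a b
    edge⇒consecutive {a} {b} h
      with i , _ , e ← find (does-true (any? (λ i → _ ≟ true) (allFin _)) h)
      with ∨-true⁻ {vtx (inject₁ i) == a ∧ vtx (suc i) == b} e
    ... | inj₁ e′ = let p , q = ∧-true⁻ e′ in i , inj₁ (==-true p , ==-true q)
    ... | inj₂ e′ = let p , q = ∧-true⁻ e′ in i , inj₂ (==-true p , ==-true q)

    consecutive⇒edge : ∀ {a b} → Consecutive a b → PE a b ≡ true
    consecutive⇒edge {a} {b} (i , h) = true-does (any? (λ i → _ ≟ true) (allFin _)) (lose (∈-allFin i) (holds h))
      where
      holds : (vtx (inject₁ i) ≡ a × vtx (suc i) ≡ b) ⊎ (vtx (inject₁ i) ≡ b × vtx (suc i) ≡ a) →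
        ((vtx (inject₁ i) == a ∧ vtx (suc i) == b) ∨ (vtx (inject₁ i) == b ∧ vtx (suc i) == a)) ≡ true
      holds (inj₁ (refl , refl)) rewrite ==-refl (vtx (inject₁ i)) | ==-refl (vtx (suc i)) = refl
      holds (inj₂ (refl , refl)) rewrite ==-refl (vtx (inject₁ i)) | ==-refl (vtx (suc i)) = Bool.∨-zeroʳ _

    edge-sym : ∀ {a b} → PE a b ≡ true → PE b a ≡ true
    edge-sym h with edge⇒consecutive h
    ... | i , inj₁ e = consecutive⇒edge (i , inj₂ e)
    ... | i , inj₂ e = consecutive⇒edge (i , inj₁ e)

    PE-sym : ∀ a b → PE a b ≡ PE b a
    PE-sym a b = bool-ext edge-sym edge-sym

    edge⇒T : ∀ {a b} → PE a b ≡ true → T a b ≡ true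
    edge⇒T h with edge⇒consecutive h
    ... | i , inj₁ (refl , refl) = adjacent i
    ... | i , inj₂ (refl , refl) = trans (symmetric _ _) (adjacent i)

    onPath⇒ : ∀ {v} → onPath v ≡ true → ∃[ i ] vtx i ≡ v
    onPath⇒ h with i , _ , e ← find (does-true (any? (λ i → _ Fin.≟ _) (allFin _)) h) = i , e

    ⇒onPath : ∀ i → onPath (vtx i) ≡ true
    ⇒onPath i = true-does (any? (λ j → vtx j Fin.≟ vtx i) (allFin _)) (lose (∈-allFin i) refl)

    edge⇒onPath : ∀ {a b} → PE a b ≡ true → ∃[ i ] vtx i ≡ b
    edge⇒onPath h with edge⇒consecutive h
    ... | i , inj₁ (_ , e) = suc i , e
    ... | i , inj₂ (e , _) = inject₁ i , e

    N-sym : ∀ a b → N a b ≡ N b a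
    N-sym a b = cong₂ _∧_ (symmetric a b) (cong not (PE-sym a b))

    N⇒T : ∀ {a b} → N a b ≡ true → T a b ≡ true
    N⇒T h = proj₁ (∧-true⁻ h)

    N⇒¬PE : ∀ {a b} → N a b ≡ true → PE a b ≡ false
    N⇒¬PE {a} {b} h = Bool.not-injective (proj₂ (∧-true⁻ {T a b} h))

    T-cases : ∀ {a b} → T a b ≡ true → PE a b ≡ true ⊎ N a b ≡ true
    T-cases {a} {b} h with PE a b
    ... | true = inj₁ refl
    ... | false rewrite h = inj₂ refl

    bit-T : ∀ a b → bit (T a b) ≡ bit (N a b) ℕ.+ bit (PE a b)
    bit-T a b with PE a b in e
    ... | true rewrite edge⇒T e = refl
    ... | false = trans (cong bit (sym (Bool.∧-identityʳ _))) (sym (ℕ.+-identityʳ _))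

    -- An internal vertex already has its two path neighbours, so a third neighbour would
    -- push its degree above 2.
    internal-edge : ∀ i {v} → T (internal i) v ≡ true → PE (internal i) v ≡ true
    internal-edge i {v} h with PE (internal i) v in e
    ... | true = refl
    ... | false = ⊥-elim (ℕ.<-irrefl (sym (trans (sym (deg-count T x)) (deg2 i))) three≤)
      where
      x = internal i
      p = vtx (inject₁ (inject₁ i))
      r = vtx (suc (suc i))
      xp : PE x p ≡ true
      xp = consecutive⇒edge (inject₁ i , inj₂ (refl , refl))
      xr : PE x r ≡ true
      xr = consecutive⇒edge (suc i , inj₁ (refl , refl))
      v≢ : ∀ {u} → PE x u ≡ true → v ≢ u
      v≢ xu refl with () ← trans (sym xu) e
      p≢r : p ≢ r
      p≢r = inject₁²≢suc² i ∘ injective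
      one : ∀ u → Σ[ allFin n ] (λ a → bit (a == u)) ≡ 1
      one u = count-single u (==-refl u) (λ _ → ==-true)
      -- The indicators of three distinct neighbours lie pointwise below the row of `x`; summing
      -- them bounds the degree without listing neighbours.
      bound : ∀ a → bit (a == p) ℕ.+ (bit (a == r) ℕ.+ bit (a == v)) ≤ bit (T x a)
      bound a with a Fin.≟ p | a Fin.≟ r | a Fin.≟ v
      ... | yes refl | yes q | _ = ⊥-elim (p≢r q)
      ... | yes refl | no _ | yes q = ⊥-elim (v≢ xp (sym q))
      ... | yes refl | no _ | no _ rewrite edge⇒T xp = ℕ.≤-refl
      ... | no _ | yes refl | yes q = ⊥-elim (v≢ xr (sym q))
      ... | no _ | yes refl | no _ rewrite edge⇒T xr = ℕ.≤-refl
      ... | no _ | no _ | yes refl rewrite h = ℕ.≤-refl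
      ... | no _ | no _ | no _ = z≤n
      three≤ : 3 ≤ count (T x)
      three≤ = subst (_≤ count (T x))
        (trans (Σ-+ (allFin n) _ _) (cong₂ ℕ._+_ (one p) (trans (Σ-+ (allFin n) _ _) (cong₂ ℕ._+_ (one r) (one v)))))
        (Σ-≤ (allFin n) bound)

    internal-N : ∀ i {v} → N (internal i) v ≢ true
    internal-N i h with () ← trans (sym (internal-edge i (N⇒T h))) (N⇒¬PE h)

    -- If a walk avoids the path edges and joins the ends of the path, then the first path edge
    -- lies on a cycle: T stays connected without it, yet has too few edges left for that.
    no-bypass : ¬ Walk N start end
    no-bypass W = ℕ.<-irrefl refl (begin-strict
      2 ℕ.* (n ℕ.∸ 1)                          ≤⟨ connected⇒entries≥ T⁻ T⁻-sym (λ a b → lift (connected a b)) ⟩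
      entries T⁻ (allFin n)                    <⟨ ℕ.m<m+n _ {2} (s≤s z≤n) ⟩
      entries T⁻ (allFin n) ℕ.+ 2              ≡⟨ cong (entries T⁻ (allFin n) ℕ.+_) firstEdge-entries ⟨
      entries T⁻ (allFin n) ℕ.+ entries firstEdge (allFin n)
        ≡⟨ Σ-+ (allFin n) (λ a → count (T⁻ a)) (λ a → count (firstEdge a)) ⟨
      Σ[ allFin n ] (λ a → count (T⁻ a) ℕ.+ count (firstEdge a))
        ≡⟨ Σ-cong (allFin n) (λ a → trans (sym (Σ-+ (allFin n) _ _)) (Σ-cong (allFin n) (bit-T⁻ a))) ⟩
      Σ[ allFin n ] (λ a → count (T a))        ≡⟨ Σ-cong (allFin n) (λ a → sym (deg-count T a)) ⟩
      sumℕ (map (deg T) (allFin n))            ≡⟨ edgeCount ⟩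
      2 ℕ.* (n ℕ.∸ 1)                          ∎)
      where
      open ℕ.≤-Reasoning hiding (start)
      s = start
      v₁ = vtx (suc zero)
      s≢v₁ : s ≢ v₁
      s≢v₁ e with () ← injective e

      firstEdge T⁻ : Graph n
      firstEdge a b = (a == s ∧ b == v₁) ∨ (a == v₁ ∧ b == s)
      T⁻ a b = T a b ∧ not (firstEdge a b)

      firstEdge⇒ : ∀ {a b} → firstEdge a b ≡ true → (a ≡ s × b ≡ v₁) ⊎ (a ≡ v₁ × b ≡ s)
      firstEdge⇒ {a} {b} h with ∨-true⁻ {a == s ∧ b == v₁} h
      ... | inj₁ e = let p , q = ∧-true⁻ e in inj₁ (==-true p , ==-true q)
      ... | inj₂ e = let p , q = ∧-true⁻ e in inj₂ (==-true p , ==-true q)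

      firstEdge⇒PE : ∀ {a b} → firstEdge a b ≡ true → PE a b ≡ true
      firstEdge⇒PE {a} {b} h with firstEdge⇒ {a} {b} h
      ... | inj₁ (refl , refl) = consecutive⇒edge (zero , inj₁ (refl , refl))
      ... | inj₂ (refl , refl) = consecutive⇒edge (zero , inj₂ (refl , refl))

      firstEdge-sym : ∀ a b → firstEdge a b ≡ firstEdge b a
      firstEdge-sym a b = trans (Bool.∨-comm (a == s ∧ b == v₁) _)
        (cong₂ _∨_ (Bool.∧-comm (a == v₁) _) (Bool.∧-comm (a == s) _))

      T⁻-sym : ∀ a b → T⁻ a b ≡ T⁻ b a
      T⁻-sym a b = cong₂ _∧_ (symmetric a b) (cong not (firstEdge-sym a b))

      bit-T⁻ : ∀ a b → bit (T⁻ a b) ℕ.+ bit (firstEdge a b) ≡ bit (T a b)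
      bit-T⁻ a b with firstEdge a b in e
      ... | true rewrite edge⇒T (firstEdge⇒PE {a} {b} e) = refl
      ... | false = trans (ℕ.+-identityʳ _) (cong bit (Bool.∧-identityʳ _))

      indicator : ∀ u → count (_== u) ≡ 1
      indicator u = count-single u (==-refl u) (λ _ → ==-true)

      firstEdge-count : ∀ a → count (firstEdge a) ≡ bit (a == s) ℕ.+ bit (a == v₁)
      firstEdge-count a with a Fin.≟ s | a Fin.≟ v₁
      ... | yes refl | yes q = ⊥-elim (s≢v₁ q)
      ... | yes refl | no _ = trans (count-cong {h = _== v₁} (λ v → Bool.∨-identityʳ (v == v₁))) (indicator v₁)
      ... | no _ | yes refl = indicator s
      ... | no _ | no _ = Σ-zero (allFin n)

      firstEdge-entries : entries firstEdge (allFin n) ≡ 2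
      firstEdge-entries = trans (Σ-cong (allFin n) firstEdge-count)
        (trans (Σ-+ (allFin n) (λ a → bit (a == s)) _) (cong₂ ℕ._+_ (indicator s) (indicator v₁)))

      N⇒T⁻ : ∀ {a b} → N a b ≡ true → T⁻ a b ≡ true
      N⇒T⁻ {a} {b} h with firstEdge a b in e
      ... | true with () ← trans (sym (firstEdge⇒PE {a} {b} e)) (N⇒¬PE h)
      ... | false = trans (Bool.∧-identityʳ _) (N⇒T h)

      embed : ∀ {a b} → Walk N a b → Walk T⁻ a b
      embed here = here
      embed (step e w) = step (N⇒T⁻ e) (embed w)

      later : ∀ i → T⁻ (vtx (suc (suc i))) (vtx (suc (inject₁ i))) ≡ true
      later i with firstEdge (vtx (suc (suc i))) (vtx (suc (inject₁ i))) in e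
      ... | false = trans (Bool.∧-identityʳ _) (trans (symmetric _ _) (adjacent (suc i)))
      ... | true with firstEdge⇒ {vtx (suc (suc i))} {vtx (suc (inject₁ i))} e
      ...   | inj₁ (p , _) with () ← injective p
      ...   | inj₂ (_ , p) with () ← injective p

      descend : ∀ {k} (φ : Fin (suc k) → Fin n) → (∀ i → T⁻ (φ (suc i)) (φ (inject₁ i)) ≡ true) →
        Walk T⁻ (φ (fromℕ k)) (φ zero)
      descend {zero} φ h = here
      descend {suc k} φ h = descend (φ ∘ suc) (h ∘ suc) ◅◅ step (h zero) here

      -- The rest of the cycle: along the bypass to the end, then back along the path to its second
      -- vertex. It replaces the deleted edge in either direction.
      detour : Walk T⁻ s v₁
      detour = embed W ◅◅ descend (vtx ∘ suc) later

      lift : ∀ {a b} → Walk T a b → Walk T⁻ a b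
      lift here = here
      lift (step {u = a} {v = b} e w) with firstEdge a b in eq
      ... | false = step (trans (cong (T a b ∧_) (cong not eq)) (trans (Bool.∧-identityʳ _) e)) (lift w)
      ... | true with firstEdge⇒ {a} {b} eq
      ...   | inj₁ (refl , refl) = detour ◅◅ lift w
      ...   | inj₂ (refl , refl) = reverse T⁻-sym detour ◅◅ lift w

    -- The path is induced: an extra edge at an interior vertex would exceed its degree, and a chord
    -- between the two ends would be a bypass of one step.
    path-edge : ∀ i j → T (vtx i) (vtx j) ≡ PE (vtx i) (vtx j)
    path-edge i j = bool-ext (λ h → go (position i) (position j) h) edge⇒T
      where
      go : ∀ {i j} → Position i → Position j → T (vtx i) (vtx j) ≡ true → PE (vtx i) (vtx j) ≡ true
      go (inside i) _ h = internal-edge i h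
      go p (inside j) h = edge-sym (internal-edge j (trans (symmetric _ _) h))
      go first first h with () ← trans (sym h) (loopless _)
      go last last h with () ← trans (sym h) (loopless _)
      go first last h with T-cases h
      ... | inj₁ e = e
      ... | inj₂ e = ⊥-elim (no-bypass (step e here))
      go last first h with T-cases h
      ... | inj₁ e = e
      ... | inj₂ e = ⊥-elim (no-bypass (reverse N-sym (step e here)))

    PE-start : ∀ {v} → PE start v ≡ true → v ≡ vtx (suc zero)
    PE-start h with edge⇒consecutive h
    ... | i , inj₂ (_ , e) with () ← injective e
    ... | i , inj₁ (e , refl) with injective e
    PE-start h | zero , inj₁ (e , refl) | _ = refl

    PE-end : ∀ {v} → PE end v ≡ true → v ≡ endNbr
    PE-end h with edge⇒consecutive h
    ... | i , inj₁ (e , _) = ⊥-elim (fromℕ≢inject₁ (sym (injective e)))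
    ... | i , inj₂ (refl , e) = cong (vtx ∘ inject₁) (Fin.suc-injective (injective e))

    PE-start-next : PE start (vtx (suc zero)) ≡ true
    PE-start-next = consecutive⇒edge (zero , inj₁ (refl , refl))

    PE-end-prev : PE end endNbr ≡ true
    PE-end-prev = consecutive⇒edge (fromℕ m , inj₂ (refl , refl))

    count-PE-start : count (PE start) ≡ 1
    count-PE-start = count-single (vtx (suc zero)) PE-start-next (λ _ → PE-start)

    count-PE-end : count (PE end) ≡ 1
    count-PE-end = count-single endNbr PE-end-prev (λ _ → PE-end)

    PE-next : ∀ {i j} → toℕ j ≡ suc (toℕ i) → PE (vtx i) (vtx j) ≡ true
    PE-next {i} {suc j} e = consecutive⇒edge (j , inj₁ (cong vtx (Fin.toℕ-injective (trans (Fin.toℕ-inject₁ j) (ℕ.suc-injective e))) , refl))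

    PE-far : ∀ {i j} → suc (toℕ i) ℕ.< toℕ j → PE (vtx i) (vtx j) ≡ false
    PE-far {i} {j} lt = ≢true λ h → contra (edge⇒consecutive h)
      where
      contra : ¬ Consecutive (vtx i) (vtx j)
      contra (k , inj₁ (p , q)) with refl ← injective p | refl ← injective q =
        ℕ.<-irrefl (cong suc (Fin.toℕ-inject₁ k)) lt
      contra (k , inj₂ (p , q)) with refl ← injective p | refl ← injective q =
        ℕ.<-irrefl refl (ℕ.<-trans (ℕ.<-trans (ℕ.n<1+n _) (ℕ.n<1+n _)) (subst (suc (suc (toℕ k)) ℕ.<_) (Fin.toℕ-inject₁ k) lt))

  -- The branches at the ends of the path, and neighbourhoods after the shift.

  vertices : ∀ {n} → (Fin n → Bool) → List (Fin n)
  vertices {n} S = filter (λ v → S v ≟ true) (allFin n)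

  ∈-vertices⁺ : ∀ {n} (S : Fin n → Bool) {v} → S v ≡ true → v ∈ vertices S
  ∈-vertices⁺ S h = ∈-filter⁺ (λ v → S v ≟ true) (∈-allFin _) h

  ∈-vertices⁻ : ∀ {n} (S : Fin n → Bool) {v} → v ∈ vertices S → S v ≡ true
  ∈-vertices⁻ S h = proj₂ (∈-filter⁻ (λ v → S v ≟ true) {xs = allFin _} h)

  vertices-unique : ∀ {n} (S : Fin n → Bool) → Unique (vertices S)
  vertices-unique S = Unique.filter⁺ (λ v → S v ≟ true) (Unique.allFin⁺ _)

  -- Lists without repetition and with the same members are permutations of each other, so by
  -- `minor-↭` a determinant over `S` can be read in whichever vertex order suits the cuts.
  vertices-↭ : ∀ {n} (S : Fin n → Bool) {xs} → Unique xs →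
    (∀ {v} → v ∈ xs → S v ≡ true) → (∀ {v} → S v ≡ true → v ∈ xs) → vertices S ↭ xs
  vertices-↭ S u f g = ∼bag⇒↭ (unique∧set⇒bag (vertices-unique S) u (mk⇔ (g ∘ ∈-vertices⁻ S) (∈-vertices⁺ S ∘ f)))

  false≢true : ∀ {b} → b ≡ false → b ≢ true
  false≢true refl ()

  without : ∀ {n} → (Fin n → Bool) → Fin n → Fin n → Bool
  without S v a = S a ∧ not (a == v)

  without⁺ : ∀ {n} {S : Fin n → Bool} {v a} → S a ≡ true → a ≢ v → without S v a ≡ true
  without⁺ h ne rewrite h | ==-false ne = refl

  without⁻ : ∀ {n} {S : Fin n → Bool} {v a} → without S v a ≡ true → S a ≡ true × a ≢ v
  without⁻ {S = S} {v} {a} h with p , q ← ∧-true⁻ {S a} h =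
    p , λ { refl → false≢true (cong not (==-refl v)) q }

  ∷-unique : ∀ {a} {A : Set a} {x : A} {xs} → x ∉ xs → Unique xs → Unique (x ∷ xs)
  ∷-unique x∉ u = All.tabulate (λ where x∈ refl → x∉ x∈) ∷ u

  vertices-∷-↭ : ∀ {n} (S : Fin n → Bool) {v} → S v ≡ true → vertices S ↭ v ∷ vertices (without S v)
  vertices-∷-↭ S {v} h = vertices-↭ S
    (∷-unique (λ v∈ → proj₂ (without⁻ {S = S} (∈-vertices⁻ (without S v) v∈)) refl) (vertices-unique _))
    (λ where (here refl) → h
             (there a∈) → proj₁ (without⁻ {S = S} (∈-vertices⁻ (without S v) a∈)))
    member
    where
    member : ∀ {a} → S a ≡ true → a ∈ v ∷ vertices (without S v)
    member {a} e with a Fin.≟ v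
    ... | yes refl = here refl
    ... | no ne = there (∈-vertices⁺ (without S v) (without⁺ {S = S} e ne))

  module Decomposition {n} {T : Graph n} (tree : IsTree T) {m} (P : Path T m) (deg2 : Path.InternalDeg2 P)
    (S₁ S₂ : Fin n → Bool)
    (S₁-walk : ∀ v → (S₁ v ≡ true) ⇔ Walk (Path.minusPath P) (Path.start P) v)
    (S₂-walk : ∀ v → (S₂ v ≡ true) ⇔ Walk (Path.minusPath P) (Path.end P) v)
    where
    open IsTree tree
    open PathInTree tree P deg2 public

    private
      s = start
      e = end

    s≢e : s ≢ e
    s≢e h with () ← injective h

    internal≢s : ∀ i → internal i ≢ s
    internal≢s i h with () ← injective h

    internal≢e : ∀ i → internal i ≢ e
    internal≢e i h = fromℕ≢inject₁ (sym (Fin.suc-injective (injective h)))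

    S₁-s : S₁ s ≡ true
    S₁-s = Equivalence.from (S₁-walk s) here

    S₂-e : S₂ e ≡ true
    S₂-e = Equivalence.from (S₂-walk e) here

    S₁-closed : ∀ {a b} → S₁ a ≡ true → N a b ≡ true → S₁ b ≡ true
    S₁-closed h ab = Equivalence.from (S₁-walk _) (Equivalence.to (S₁-walk _) h ◅◅ step ab here)

    S₂-closed : ∀ {a b} → S₂ a ≡ true → N a b ≡ true → S₂ b ≡ true
    S₂-closed h ab = Equivalence.from (S₂-walk _) (Equivalence.to (S₂-walk _) h ◅◅ step ab here)

    S₁S₂-disjoint : ∀ {v} → S₁ v ≡ true → S₂ v ≢ true
    S₁S₂-disjoint h₁ h₂ = no-bypass
      (Equivalence.to (S₁-walk _) h₁ ◅◅ reverse N-sym (Equivalence.to (S₂-walk _) h₂))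

    walk-from-internal : ∀ {i v} → Walk N (internal i) v → v ≡ internal i
    walk-from-internal here = refl
    walk-from-internal {i} (step h _) = ⊥-elim (internal-N i h)

    internal∉S₁ : ∀ i → S₁ (internal i) ≢ true
    internal∉S₁ i h = internal≢s i (sym (walk-from-internal (reverse N-sym (Equivalence.to (S₁-walk _) h))))

    internal∉S₂ : ∀ i → S₂ (internal i) ≢ true
    internal∉S₂ i h = internal≢e i (sym (walk-from-internal (reverse N-sym (Equivalence.to (S₂-walk _) h))))

    Part : Fin n → Set
    Part v = S₁ v ≡ true ⊎ S₂ v ≡ true ⊎ ∃[ i ] v ≡ internal i

    -- Membership is carried along a walk in `T` from the start: a path edge lands on the path, any
    -- other edge stays inside its branch, and interior vertices have no other edges.
    partition : ∀ v → Part v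
    partition v = along (inj₁ S₁-s) (connected s v)
      where
      onPath-part : ∀ {i} → Position i → Part (vtx i)
      onPath-part first = inj₁ S₁-s
      onPath-part (inside i) = inj₂ (inj₂ (i , refl))
      onPath-part last = inj₂ (inj₁ S₂-e)
      next : ∀ {a b} → Part a → T a b ≡ true → Part b
      next pa h with T-cases h
      next pa h | inj₁ ab with i , refl ← edge⇒onPath ab = onPath-part (position i)
      next (inj₁ h₁) h | inj₂ ab = inj₁ (S₁-closed h₁ ab)
      next (inj₂ (inj₁ h₂)) h | inj₂ ab = inj₂ (inj₁ (S₂-closed h₂ ab))
      next (inj₂ (inj₂ (i , refl))) h | inj₂ ab = ⊥-elim (internal-N i ab)
      along : ∀ {a b} → Part a → Walk T a b → Part b
      along pa here = pa
      along pa (step h w) = along (next pa h) w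

    In₁ In₂ : Fin n → Set
    In₁ v = S₁ v ≡ true × v ≢ s
    In₂ v = S₂ v ≡ true × v ≢ e

    In₁-offPath : ∀ {v} → In₁ v → ∀ i → vtx i ≢ v
    In₁-offPath (h , ne) i refl with position i
    ... | first = ne refl
    ... | inside j = internal∉S₁ j h
    ... | last = S₁S₂-disjoint h S₂-e

    In₂-offPath : ∀ {v} → In₂ v → ∀ i → vtx i ≢ v
    In₂-offPath (h , ne) i refl with position i
    ... | first = S₁S₂-disjoint S₁-s h
    ... | inside j = internal∉S₂ j h
    ... | last = ne refl

    offPath-T : ∀ {a} → (∀ i → vtx i ≢ a) → ∀ {b} → T a b ≡ true → N a b ≡ true
    offPath-T off h with T-cases h
    ... | inj₂ ab = ab
    ... | inj₁ ab with i , eq ← edge⇒onPath (edge-sym ab) = ⊥-elim (off i eq)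

    In₁-T : ∀ {a b} → In₁ a → T a b ≡ true → S₁ b ≡ true
    In₁-T a∈ h = S₁-closed (proj₁ a∈) (offPath-T (In₁-offPath a∈) h)

    In₂-T : ∀ {a b} → In₂ a → T a b ≡ true → S₂ b ≡ true
    In₂-T a∈ h = S₂-closed (proj₁ a∈) (offPath-T (In₂-offPath a∈) h)

    -- Whole rows are compared, so that the degree counted in `T` and the degree counted within `S₁`
    -- agree, and with them the diagonal entries.
    In₁-row : ∀ {a} → In₁ a → ∀ v → T a v ≡ S₁ v ∧ N a v
    In₁-row a∈ v = bool-ext
      (λ h → cong₂ _∧_ (In₁-T a∈ h) (offPath-T (In₁-offPath a∈) h))
      (λ h → N⇒T (proj₂ (∧-true⁻ {S₁ v} h)))

    In₂-row : ∀ {a} → In₂ a → ∀ v → T a v ≡ S₂ v ∧ N a v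
    In₂-row a∈ v = bool-ext
      (λ h → cong₂ _∧_ (In₂-T a∈ h) (offPath-T (In₂-offPath a∈) h))
      (λ h → N⇒T (proj₂ (∧-true⁻ {S₂ v} h)))

    s-row : ∀ v → N s v ≡ S₁ v ∧ N s v
    s-row v = bool-ext (λ h → cong₂ _∧_ (S₁-closed S₁-s h) h) (λ h → proj₂ (∧-true⁻ {S₁ v} h))

    e-row : ∀ v → N e v ≡ S₂ v ∧ N e v
    e-row v = bool-ext (λ h → cong₂ _∧_ (S₂-closed S₂-e h) h) (λ h → proj₂ (∧-true⁻ {S₂ v} h))

    onPath-row : ∀ a v → PE a v ≡ onPath v ∧ PE a v
    onPath-row a v = bool-ext on (λ h → proj₂ (∧-true⁻ {onPath v} h))
      where
      on : PE a v ≡ true → onPath v ∧ PE a v ≡ true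
      on h with i , refl ← edge⇒onPath h = cong₂ _∧_ (⇒onPath i) h

    internal-row : ∀ i v → T (internal i) v ≡ PE (internal i) v
    internal-row i v = bool-ext (internal-edge i) edge⇒T

    degree₁ degree₂ : ℕ
    degree₁ = count λ v → S₁ v ∧ N s v
    degree₂ = count λ v → S₂ v ∧ N e v

    count-T : ∀ a → count (T a) ≡ count (N a) ℕ.+ count (PE a)
    count-T a = trans (Σ-cong (allFin n) (bit-T a)) (Σ-+ (allFin n) (bit ∘ N a) (bit ∘ PE a))

    count-T-s : count (T s) ≡ degree₁ ℕ.+ 1
    count-T-s = trans (count-T s) (cong₂ ℕ._+_ (count-cong s-row) count-PE-start)

    count-T-e : count (T e) ≡ degree₂ ℕ.+ 1
    count-T-e = trans (count-T e) (cong₂ ℕ._+_ (count-cong e-row) count-PE-end)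

    count-T-internal : ∀ i → count (T (internal i)) ≡ 2
    count-T-internal i = trans (sym (deg-count T (internal i))) (deg2 i)

    shifted : Graph n
    shifted = shiftAlong P

    T-endNbr : ∀ {i} → T e (vtx i) ≡ true → vtx i ≡ endNbr
    T-endNbr {i} h = PE-end (trans (sym (path-edge (fromℕ (suc m)) i)) h)

    shifted-In₁ : ∀ {a} → In₁ a → ∀ v → shifted a v ≡ T a v
    shifted-In₁ {a} a∈ v
      rewrite ==-false {a = a} {e} (In₁-offPath a∈ _ ∘ sym) | ==-false (proj₂ a∈)
      with v Fin.≟ e
    ... | yes refl = trans (cong (_ ∧_) Tae) (trans (Bool.∧-zeroʳ _) (sym Tae))
      where
      Tae : T a e ≡ false
      Tae = ≢true (λ h → S₁S₂-disjoint (In₁-T a∈ h) S₂-e)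
    ... | no _ with v Fin.≟ s
    ...   | no _ = refl
    ...   | yes refl = trans (cong (λ b → T a s ∨ (b ∧ _)) Tea) (Bool.∨-identityʳ _)
      where
      Tea : T e a ≡ false
      Tea = trans (symmetric e a) (≢true (λ h → S₁S₂-disjoint (In₁-T a∈ h) S₂-e))

    In₂-T-s : ∀ {a} → In₂ a → T a s ≡ false
    In₂-T-s a∈ = ≢true (λ h → S₁S₂-disjoint S₁-s (In₂-T a∈ h))

    shifted-In₂ : ∀ {a} → In₂ a → ∀ {v} → v ≢ s → v ≢ e → shifted a v ≡ T a v
    shifted-In₂ {a} a∈ v≢s v≢e
      rewrite ==-false (proj₂ a∈) | ==-false v≢e | ==-false {a = a} {s} (In₂-offPath a∈ _ ∘ sym) | ==-false v≢s = refl

    shifted-In₂-s : ∀ {a} → In₂ a → shifted a s ≡ T a e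
    shifted-In₂-s {a} a∈
      rewrite ==-false (proj₂ a∈) | ==-false s≢e | ==-false {a = a} {s} (In₂-offPath a∈ _ ∘ sym) | ==-refl s
        | In₂-T-s a∈ | ==-false {a = a} {endNbr} (In₂-offPath a∈ _ ∘ sym)
      = trans (Bool.∧-identityʳ _) (symmetric e a)

    shifted-In₂-e : ∀ {a} → In₂ a → shifted a e ≡ false
    shifted-In₂-e {a} a∈
      rewrite ==-false (proj₂ a∈) | ==-refl e | ==-false {a = a} {endNbr} (In₂-offPath a∈ _ ∘ sym) = refl

    shifted-internal : ∀ i v → shifted (internal i) v ≡ T (internal i) v
    shifted-internal i v
      rewrite ==-false (internal≢e i) | ==-false (internal≢s i)
      with v Fin.≟ e
    ... | yes refl = bool-ext (λ h → proj₂ (∧-true⁻ {internal i == endNbr} h))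
            (λ h → cong₂ _∧_ (trans (cong (_== endNbr) (T-endNbr (trans (symmetric e _) h))) (==-refl endNbr)) h)
    ... | no _ with v Fin.≟ s
    ...   | no _ = refl
    ...   | yes refl = trans (cong (T (internal i) s ∨_) (≢true far)) (Bool.∨-identityʳ _)
      where
      far : T e (internal i) ∧ not (internal i == endNbr) ≢ true
      far h with p , q ← ∧-true⁻ {T e (internal i)} h =
        false≢true (cong not (trans (cong (_== endNbr) (T-endNbr p)) (==-refl endNbr))) q

    PE-e : ∀ v → PE e v ≡ (v == endNbr)
    PE-e v = bool-ext (λ h → trans (cong (_== endNbr) (PE-end h)) (==-refl endNbr))
      (λ h → subst (λ u → PE e u ≡ true) (sym (==-true h)) PE-end-prev)

    shifted-e : ∀ v → shifted e v ≡ PE e v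
    shifted-e v rewrite ==-refl e = bool-ext
      (λ h → trans (PE-e v) (proj₁ (∧-true⁻ {v == endNbr} h)))
      (λ h → cong₂ _∧_ (trans (sym (PE-e v)) h) (edge⇒T h))

    N-loopless : ∀ v → N v v ≡ false
    N-loopless v = cong (_∧ not (PE v v)) (loopless v)

    -- The case of substance is a path of one edge: then `endNbr` is the start, and the shift spares
    -- this edge.
    shifted-s-e : shifted s e ≡ T s e
    shifted-s-e rewrite ==-false s≢e | ==-refl e = bool-ext
      (λ h → proj₂ (∧-true⁻ {s == endNbr} h))
      (λ h → cong₂ _∧_ (trans (cong (_== endNbr) (T-endNbr {zero} (trans (symmetric e s) h))) (==-refl endNbr)) h)

    shifted-s-off : ∀ {v} → v ≢ e → shifted s v ≡ T s v ∨ (T e v ∧ not (v == endNbr))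
    shifted-s-off v≢e rewrite ==-false s≢e | ==-false v≢e | ==-refl s = refl

    -- The neighbours taken over from the end are new to the start: a common one would lie in both
    -- branches, or in H₂ off its root and also on the path. Hence degrees add.
    shifted-s : ∀ v → bit (shifted s v) ≡ bit (T s v) ℕ.+ bit (N e v)
    shifted-s v = go (v Fin.≟ e)
      where
      disjoint-∨ : ∀ {a b} → (a ≡ true → b ≢ true) → bit (a ∨ b) ≡ bit a ℕ.+ bit b
      disjoint-∨ {true} {true} h = ⊥-elim (h refl refl)
      disjoint-∨ {true} {false} h = refl
      disjoint-∨ {false} h = refl
      exclusive : v ≢ e → T s v ≡ true → N e v ≢ true
      exclusive v≢e h h′ with v∈S₂ ← S₂-closed S₂-e h′ | T-cases h
      ... | inj₂ sv = S₁S₂-disjoint (S₁-closed S₁-s sv) v∈S₂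
      ... | inj₁ sv with i , eq ← edge⇒onPath sv = In₂-offPath (v∈S₂ , v≢e) i eq
      go : Dec (v ≡ e) → bit (shifted s v) ≡ bit (T s v) ℕ.+ bit (N e v)
      go (yes refl) = trans (cong bit shifted-s-e)
            (trans (sym (ℕ.+-identityʳ _)) (cong (λ b → bit (T s e) ℕ.+ bit b) (sym (N-loopless e))))
      go (no v≢e) = trans
            (cong bit (trans (shifted-s-off v≢e) (cong (λ b → T s v ∨ (T e v ∧ not b)) (sym (PE-e v)))))
            (disjoint-∨ (exclusive v≢e))

    count-shifted-s : count (shifted s) ≡ degree₁ ℕ.+ 1 ℕ.+ degree₂
    count-shifted-s = trans (Σ-cong (allFin n) shifted-s)
      (trans (Σ-+ (allFin n) (bit ∘ T s) (bit ∘ N e)) (cong₂ ℕ._+_ count-T-s (count-cong e-row)))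

    count-shifted-e : count (shifted e) ≡ 1
    count-shifted-e = trans (count-cong shifted-e) count-PE-end

    V₁ V₂ Q : List (Fin n)
    V₁ = vertices (without S₁ s)
    V₂ = vertices (without S₂ e)
    Q = tabulate internal

    ∈V₁ : ∀ {v} → v ∈ V₁ → In₁ v
    ∈V₁ h = without⁻ {S = S₁} (∈-vertices⁻ (without S₁ s) h)

    ∈V₂ : ∀ {v} → v ∈ V₂ → In₂ v
    ∈V₂ h = without⁻ {S = S₂} (∈-vertices⁻ (without S₂ e) h)

    ∈Q : ∀ {v} → v ∈ Q → ∃[ i ] v ≡ internal i
    ∈Q = ∈-tabulate⁻

    In₁-∉ : ∀ {v} → v ∈ e ∷ Q ++ V₂ → ¬ In₁ v
    In₁-∉ (here refl) v∈ = In₁-offPath v∈ _ refl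
    In₁-∉ (there h) v∈ with ∈-++⁻ Q h
    ... | inj₁ q with i , refl ← ∈Q q = In₁-offPath v∈ _ refl
    ... | inj₂ h₂ = S₁S₂-disjoint (proj₁ v∈) (proj₁ (∈V₂ h₂))

    Q-unique : Unique Q
    Q-unique = Unique.tabulate⁺ (λ h → Fin.inject₁-injective (Fin.suc-injective (injective h)))

    e∉Q : e ∉ Q
    e∉Q h with i , eq ← ∈Q h = internal≢e i (sym eq)

    vertices-path : vertices onPath ↭ s ∷ e ∷ Q
    vertices-path = ↭.trans
      (vertices-↭ onPath {tabulate vtx} (Unique.tabulate⁺ injective)
        (λ h → on (∈-tabulate⁻ h))
        (λ h → let i , eq = onPath⇒ h in subst (_∈ tabulate vtx) eq (∈-tabulate⁺ {f = vtx} i)))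
      (↭.prep s (tabulate-last-↭ (vtx ∘ suc)))
      where
      on : ∀ {v} → (∃[ i ] v ≡ vtx i) → onPath v ≡ true
      on (i , refl) = ⇒onPath i

    vertices-path⁻ : vertices (without onPath s) ↭ e ∷ Q
    vertices-path⁻ = ↭.drop-∷ (↭.trans (↭.↭-sym (vertices-∷-↭ onPath (⇒onPath zero))) vertices-path)

    -- The order is the one in which `minor-split` and `minor-join` cut the tree. An arbitrary
    -- constantly true `S` is taken because `allV` is only available over a field.
    vertices-all : (S : Fin n → Bool) → (∀ v → S v ≡ true) → vertices S ↭ s ∷ V₁ ++ (e ∷ Q ++ V₂)
    vertices-all S all = vertices-↭ S
      (∷-unique s∉ (Unique.++⁺ (vertices-unique _)
        (∷-unique e∉ (Unique.++⁺ Q-unique (vertices-unique _) QV₂-disjoint))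
        (λ (h₁ , h) → In₁-∉ h (∈V₁ h₁))))
      (λ _ → all _) (λ _ → member _ (partition _))
      where
      s∉ : s ∉ V₁ ++ (e ∷ Q ++ V₂)
      s∉ h with ∈-++⁻ V₁ h
      ... | inj₁ h₁ = proj₂ (∈V₁ h₁) refl
      ... | inj₂ (here eq) = s≢e eq
      ... | inj₂ (there h′) with ∈-++⁻ Q h′
      ...   | inj₁ q with i , eq ← ∈Q q = internal≢s i (sym eq)
      ...   | inj₂ h₂ = In₂-offPath (∈V₂ h₂) zero refl
      e∉ : e ∉ Q ++ V₂
      e∉ h with ∈-++⁻ Q h
      ... | inj₁ q = e∉Q q
      ... | inj₂ h₂ = proj₂ (∈V₂ h₂) refl
      QV₂-disjoint : ∀ {v} → ¬ (v ∈ Q × v ∈ V₂)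
      QV₂-disjoint (q , h₂) with i , refl ← ∈Q q = internal∉S₂ i (proj₁ (∈V₂ h₂))
      member : ∀ v → Part v → v ∈ s ∷ V₁ ++ (e ∷ Q ++ V₂)
      member v (inj₁ h) with v Fin.≟ s
      ... | yes refl = here refl
      ... | no ne = there (∈-++⁺ˡ (∈-vertices⁺ (without S₁ s) (without⁺ {S = S₁} h ne)))
      member v (inj₂ (inj₁ h)) with v Fin.≟ e
      ... | yes refl = there (∈-++⁺ʳ V₁ (here refl))
      ... | no ne = there (∈-++⁺ʳ V₁ (there (∈-++⁺ʳ Q (∈-vertices⁺ (without S₂ e) (without⁺ {S = S₂} h ne)))))
      member v (inj₂ (inj₂ (i , refl))) = there (∈-++⁺ʳ V₁ (there (∈-++⁺ˡ (∈-tabulate⁺ {f = internal} i))))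

    allFin-↭ : allFin n ↭ s ∷ e ∷ (V₁ ++ (Q ++ V₂))
    allFin-↭ = ↭.trans (subst (_↭ s ∷ V₁ ++ (e ∷ Q ++ V₂)) (List.filter-all (λ _ → true ≟ true) (All.tabulate (λ _ → refl)))
      (vertices-all (λ _ → true) (λ _ → refl))) (↭.prep s (↭.shift e V₁ (Q ++ V₂)))

    -- The row of `a` has its entries at `s` and `e` exchanged, the entry at `s` having been false.
    -- The rows may differ, but the degree, and hence the diagonal entry, survives.
    count-shifted-In₂ : ∀ {a} → In₂ a → count (shifted a) ≡ count (T a)
    count-shifted-In₂ {a} a∈ = begin
      count (shifted a)                        ≡⟨ Σ-↭ allFin-↭ (bit ∘ shifted a) ⟩
      bit (shifted a s) ℕ.+ (bit (shifted a e) ℕ.+ Σ[ rest ] (bit ∘ shifted a))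
        ≡⟨ cong₂ ℕ._+_ (cong bit (shifted-In₂-s a∈)) (cong₂ ℕ._+_ (cong bit (trans (shifted-In₂-e a∈) (sym (In₂-T-s a∈)))) (Σ-cong-∈ rest off)) ⟩
      bit (T a e) ℕ.+ (bit (T a s) ℕ.+ Σ[ rest ] (bit ∘ T a))
        ≡⟨ solve 3 (λ x y z → x :+ (y :+ z) := y :+ (x :+ z)) refl (bit (T a e)) (bit (T a s)) _ ⟩
      bit (T a s) ℕ.+ (bit (T a e) ℕ.+ Σ[ rest ] (bit ∘ T a))
        ≡⟨ Σ-↭ allFin-↭ (bit ∘ T a) ⟨
      count (T a)                              ∎
      where
      open ≡.≡-Reasoning
      open +-*-Solver
      rest = V₁ ++ (Q ++ V₂)
      Σ-cong-∈ : ∀ xs {f g : Fin n → ℕ} → (∀ {v} → v ∈ xs → f v ≡ g v) → Σ[ xs ] f ≡ Σ[ xs ] g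
      Σ-cong-∈ [] h = refl
      Σ-cong-∈ (x ∷ xs) h = cong₂ ℕ._+_ (h (here refl)) (Σ-cong-∈ xs (h ∘ there))
      off : ∀ {v} → v ∈ rest → bit (shifted a v) ≡ bit (T a v)
      off h with ∈-++⁻ V₁ h
      ... | inj₁ h₁ = cong bit (shifted-In₂ a∈ (proj₂ (∈V₁ h₁)) (In₁-offPath (∈V₁ h₁) _ ∘ sym))
      ... | inj₂ h′ with ∈-++⁻ Q h′
      ...   | inj₁ q with i , refl ← ∈Q q = cong bit (shifted-In₂ a∈ (internal≢s i) (internal≢e i))
      ...   | inj₂ h₂ = cong bit (shifted-In₂ a∈ (In₂-offPath (∈V₂ h₂) _ ∘ sym) (proj₂ (∈V₂ h₂)))

open Graphs

-- Characteristic and auxiliary polynomials of the two trees.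

module Assembly {c ℓ₁ ℓ₂} (F : HeytingField c ℓ₁ ℓ₂) where
  open WithField F
  open FieldDeterminant F
  open CommutativeRing R hiding (zero) renaming (Carrier to K)
  open DifferenceSolver R using (solve; _:-_; :-_; _:=_; :0)
  open import Algebra.Properties.Semiring.Mult semiring using (×-homo-+) renaming (_×_ to _·_)
  open ListDeterminant R
  open import Relation.Binary.Reasoning.Setoid setoid hiding (start)

  -- Deleting a vertex in `charPolyDel` leaves the degrees counted in all of `S`, so both
  -- determinants of an auxiliary polynomial are minors of this one matrix.
  charMatrix : ∀ {n} → Graph n → (Fin n → Bool) → K → K → Fin n → Fin n → K
  charMatrix G S q x a b = (if a == b then x else 0#) - qLap G S q a b

  sumK-count : ∀ {a} {A : Set a} (g : A → Bool) xs → sumK (map (b2K ∘ g) xs) ≈ (Σ[ xs ] (bit ∘ g)) · 1#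
  sumK-count g [] = refl
  sumK-count g (x ∷ xs) with g x
  ... | true = +-congˡ (sumK-count g xs)
  ... | false = trans (+-identityˡ _) (sumK-count g xs)

  module _ {n : ℕ} (q x : K) where
    open Shift R (Fin._≟_ {n})
    open Chains R (Fin._≟_ {n})

    private
      M : Graph n → (Fin n → Bool) → Fin n → Fin n → K
      M G S = charMatrix G S q x
      δ = diagonalEntry q x

    δ-cong : ∀ {d d′} → d ≈ d′ → δ d ≈ δ d′
    δ-cong h = minus-cong refl (+-congˡ (*-congˡ (minus-cong h refl)))

    diagonal-count : ∀ G S a {d} → count (λ v → S v ∧ G a v) ≡ d → M G S a a ≈ δ (d · 1#)
    diagonal-count G S a h rewrite ==-refl a =
      δ-cong (trans (sumK-count (λ v → S v ∧ G a v) (allFin n)) (reflexive (≡.cong (_· 1#) h)))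

    offDiagonal : ∀ G S {a b} → a ≢ b → M G S a b ≈ q * b2K (G a b)
    offDiagonal G S {a} {b} ne rewrite ==-false ne = solve 1 (λ a → :0 :- (:- a) := a) refl _

    entry-cong : ∀ G S G′ S′ a b → G a b ≡ G′ a b →
      count (λ v → S v ∧ G a v) ≡ count (λ v → S′ v ∧ G′ a v) → M G S a b ≈ M G′ S′ a b
    entry-cong G S G′ S′ a b h h′ with a Fin.≟ b
    ... | yes ≡.refl = trans (trans (reflexive (diag-eq G S)) (diagonal-count G S a h′))
                             (sym (trans (reflexive (diag-eq G′ S′)) (diagonal-count G′ S′ a ≡.refl)))
      where
      diag-eq : ∀ G S → x - (1# + (q * q) * (sumK (map (λ v → b2K (S v ∧ G a v)) (allFin n)) - 1#)) ≡ M G S a a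
      diag-eq G S rewrite ==-refl a = ≡.refl
    ... | no ne = minus-cong refl (-‿cong (*-congˡ (reflexive (≡.cong b2K h))))

    entry-zero : ∀ G S {a b} → a ≢ b → G a b ≡ false → M G S a b ≈ 0#
    entry-zero G S ne h = trans (offDiagonal G S ne) (trans (*-congˡ (reflexive (≡.cong b2K h))) (zeroʳ q))

    separated : ∀ G S {xs ys} → (∀ a b → G a b ≡ G b a) →
      (∀ {a b} → a ∈ xs → b ∈ ys → a ≢ b ⊗ G a b ≡ false) → Separated (M G S) xs ys
    separated G S sm h a∈ b∈ = let ne , z = h a∈ b∈ in
      entry-zero G S ne z , entry-zero G S (ne ∘ ≡.sym) (≡.trans (sm _ _) z)

    detOn-↭ : ∀ G S S′ {xs} → vertices S′ ↭ xs → detOn S′ (M G S) ≈ minor (M G S) xs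
    detOn-↭ G S S′ p = trans (detOn-minor S′ (M G S)) (minor-↭ (M G S) p)

    module _ {T : Graph n} (tree : IsTree T) {m} (P : Path T m) (deg2 : Path.InternalDeg2 P)
      (tree′ : IsTree (shiftAlong P)) (S₁ S₂ : Fin n → Bool)
      (S₁-walk : ∀ v → (S₁ v ≡ true) ⇔ Walk (Path.minusPath P) (Path.start P) v)
      (S₂-walk : ∀ v → (S₂ v ≡ true) ⇔ Walk (Path.minusPath P) (Path.end P) v) where
      open Decomposition tree P deg2 S₁ S₂ S₁-walk S₂-walk
      open IsTree tree using (symmetric)
      symmetric′ = IsTree.symmetric tree′

      private
        T′ = shifted
        s = start
        e = end
        M₁ = M T allV
        M₂ = M T′ allV
        t = δ (1# + 1#)
        k₁ = degree₁ · 1#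
        k₂ = degree₂ · 1#

      -- Only adjacency between distinct path vertices enters, so the same construction serves both
      -- trees and the path taken by itself.
      chain : ∀ G S → (∀ i j → i ≢ j → G (vtx i) (vtx j) ≡ PE (vtx i) (vtx j)) → Chain q (M G S) vtx
      chain G S h = record
        { injective = injective
        ; next = λ {i} {j} eq → next (≢-next eq) (PE-next {i} {j} eq) , next (≢-next eq ∘ ≡.sym) (≡.trans (PE-sym _ _) (PE-next {i} {j} eq))
        ; far = λ {i} {j} lt → far (≢-far lt) (PE-far {i} {j} lt) , far (≢-far lt ∘ ≡.sym) (≡.trans (PE-sym _ _) (PE-far {i} {j} lt))
        }
        where
        ≢-next : ∀ {k} {i j : Fin k} → toℕ j ≡ suc (toℕ i) → i ≢ j
        ≢-next eq ≡.refl = ℕ.1+n≢n (≡.sym eq)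
        ≢-far : ∀ {k} {i j : Fin k} → suc (toℕ i) ℕ.< toℕ j → i ≢ j
        ≢-far lt ≡.refl = ℕ.<-irrefl ≡.refl (ℕ.<-trans (ℕ.n<1+n _) lt)
        next : ∀ {i j} → i ≢ j → PE (vtx i) (vtx j) ≡ true → M G S (vtx i) (vtx j) ≈ q
        next ne eq = trans (offDiagonal G S (ne ∘ injective))
          (trans (*-congˡ (reflexive (≡.cong b2K (≡.trans (h _ _ ne) eq)))) (*-identityʳ q))
        far : ∀ {i j} → i ≢ j → PE (vtx i) (vtx j) ≡ false → M G S (vtx i) (vtx j) ≈ 0#
        far ne eq = entry-zero G S (ne ∘ injective) (≡.trans (h _ _ ne) eq)

      two : 2 · 1# ≈ 1# + 1#
      two = +-congˡ (+-identityʳ 1#)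

      one : 1 · 1# ≈ 1#
      one = +-identityʳ 1#

      chain₁ : Chain q M₁ vtx
      chain₁ = chain T allV (λ i j _ → path-edge i j)

      path-edge′ : ∀ i j → i ≢ j → T′ (vtx i) (vtx j) ≡ PE (vtx i) (vtx j)
      path-edge′ i j ne = go (position i) (position j) ne
        where
        go : ∀ {i j} → Position i → Position j → i ≢ j → T′ (vtx i) (vtx j) ≡ PE (vtx i) (vtx j)
        go (inside i) _ _ = ≡.trans (shifted-internal i _) (internal-row i _)
        go last _ _ = shifted-e _
        go {i} p (inside j) _ = ≡.trans (symmetric′ (vtx i) (internal j)) (≡.trans (≡.trans (shifted-internal j _) (internal-row j _)) (PE-sym _ _))
        go {i} p last _ = ≡.trans (symmetric′ (vtx i) e) (≡.trans (shifted-e _) (PE-sym _ _))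
        go first first ne = ⊥-elim (ne ≡.refl)

      chain₂ : Chain q M₂ vtx
      chain₂ = chain T′ allV path-edge′

      chainP : Chain q (M PE onPath) vtx
      chainP = chain PE onPath (λ _ _ _ → ≡.refl)

      V₁-apart : ∀ {a b} → a ∈ V₁ → b ∈ e ∷ Q ++ V₂ → a ≢ b ⊗ T a b ≡ false
      V₁-apart {a} a∈ b∈ = (λ { ≡.refl → In₁-∉ b∈ (∈V₁ a∈) }) , ≢true (λ h → outside b∈ (In₁-T (∈V₁ a∈) h))
        where
        outside : ∀ {b} → b ∈ e ∷ Q ++ V₂ → S₁ b ≢ true
        outside {b} b∈ h with b Fin.≟ s
        ... | no ne = In₁-∉ b∈ (h , ne)
        ... | yes ≡.refl = s∉ b∈
          where
          s∉ : s ∉ e ∷ Q ++ V₂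
          s∉ (here eq) = s≢e eq
          s∉ (there h) with ∈-++⁻ Q h
          ... | inj₁ i∈ = let i , eq = ∈Q i∈ in internal≢s i (≡.sym eq)
          ... | inj₂ b∈ = In₂-offPath (∈V₂ b∈) zero ≡.refl

      V₂-apart-internal : ∀ {a b} → a ∈ V₂ → b ∈ Q → a ≢ b ⊗ T a b ≡ false
      V₂-apart-internal a∈ b∈ with i , ≡.refl ← ∈Q b∈ =
        (In₂-offPath (∈V₂ a∈) _ ∘ ≡.sym) , ≢true (internal∉S₂ i ∘ In₂-T (∈V₂ a∈))

      V₂-apart-s : ∀ {a b} → a ∈ V₂ → b ∈ s ∷ Q → a ≢ b ⊗ T a b ≡ false
      V₂-apart-s a∈ (here ≡.refl) = (In₂-offPath (∈V₂ a∈) _ ∘ ≡.sym) , In₂-T-s (∈V₂ a∈)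
      V₂-apart-s a∈ (there b∈) = V₂-apart-internal a∈ b∈

      V₁-apart′ : ∀ {a b} → a ∈ V₁ → b ∈ e ∷ Q ++ V₂ → a ≢ b ⊗ T′ a b ≡ false
      V₁-apart′ a∈ b∈ = let ne , z = V₁-apart a∈ b∈ in ne , ≡.trans (shifted-In₁ (∈V₁ a∈) _) z

      V₂-apart′ : ∀ {a b} → a ∈ V₂ → b ∈ e ∷ Q → a ≢ b ⊗ T′ a b ≡ false
      V₂-apart′ a∈ (here ≡.refl) = proj₂ (∈V₂ a∈) , shifted-In₂-e (∈V₂ a∈)
      V₂-apart′ a∈ (there b∈) with i , ≡.refl ← ∈Q b∈ = let ne , z = V₂-apart-internal a∈ b∈ in
        ne , ≡.trans (shifted-In₂ (∈V₂ a∈) (internal≢s i) (internal≢e i)) z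

      path∉V₂ : ∀ i → vtx i ∉ V₂
      path∉V₂ i h = In₂-offPath (∈V₂ h) i ≡.refl

      s∷Q∉V₂ : ∀ {b} → b ∈ s ∷ Q → b ∉ V₂
      s∷Q∉V₂ (here ≡.refl) = path∉V₂ _
      s∷Q∉V₂ (there b∈) with i , ≡.refl ← ∈Q b∈ = path∉V₂ _

      e∷Q∉V₂ : ∀ {b} → b ∈ e ∷ Q → b ∉ V₂
      e∷Q∉V₂ (here ≡.refl) = path∉V₂ _
      e∷Q∉V₂ (there b∈) with i , ≡.refl ← ∈Q b∈ = path∉V₂ _

      s∉V₁ : s ∉ V₁
      s∉V₁ h = proj₂ (∈V₁ h) ≡.refl

      private
        D₁ = minor M₁ V₁
        D₂ = minor M₁ V₂
        Y₁ = offCorner (M₁ s) M₁ s V₁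
        Y₂ = offCorner (M₁ e) M₁ e V₂
        E = inner q t m
        E⁻ = inner⁻ q t m
        ν = δ (k₂ + 1#)
        μ = δ (k₁ + 1#)
        ε = δ 1# * E - (q * q) * E⁻

      charPoly-T : charPoly T allV q x ≈
        Y₁ * (Y₂ * E + D₂ * (ν * E - (q * q) * E⁻)) +
        D₁ * (Y₂ * (μ * E - (q * q) * E⁻) + D₂ * wholePath q t μ ν m)
      charPoly-T = trans (detOn-↭ T allV allV (vertices-all allV (λ _ → ≡.refl)))
        (minor-split chain₁
          (λ i → trans (diagonal-count T allV (internal i) (count-T-internal i)) (δ-cong two))
          (trans (diagonal-count T allV s count-T-s) (δ-cong (trans (×-homo-+ 1# degree₁ 1) (+-congˡ one))))
          (trans (diagonal-count T allV e count-T-e) (δ-cong (trans (×-homo-+ 1# degree₂ 1) (+-congˡ one))))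
          s∉V₁ (λ b∈ → In₁-∉ b∈ ∘ ∈V₁) (λ h → proj₂ (∈V₂ h) ≡.refl) s∷Q∉V₂
          (separated T allV symmetric V₁-apart) (separated T allV symmetric V₂-apart-s))

      V₁-minor : minor M₂ V₁ ≈ D₁
      V₁-minor = minor-cong λ {a} {b} a∈ _ → entry-cong T′ allV T allV a b (shifted-In₁ (∈V₁ a∈) _) (count-cong (shifted-In₁ (∈V₁ a∈)))

      V₂-minor : minor M₂ V₂ ≈ D₂
      V₂-minor = minor-cong λ {a} {b} a∈ b∈ → entry-cong T′ allV T allV a b
        (shifted-In₂ (∈V₂ a∈) (In₂-offPath (∈V₂ b∈) zero ∘ ≡.sym) (proj₂ (∈V₂ b∈)))
        (count-shifted-In₂ (∈V₂ a∈))

      move-entry : ∀ G S G′ S′ {a b a′ b′} → a ≢ b → a′ ≢ b′ → G a b ≡ G′ a′ b′ → M G S a b ≈ M G′ S′ a′ b′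
      move-entry G S G′ S′ ne ne′ h = trans (offDiagonal G S ne)
        (trans (*-congˡ (reflexive (≡.cong b2K h))) (sym (offDiagonal G′ S′ ne′)))

      V₁-offCorner : offCorner (M₂ s) M₂ s V₁ ≈ Y₁
      V₁-offCorner = offCorner-cong
        (λ {a} a∈ → let ne = proj₂ (∈V₁ a∈) in
          move-entry T′ allV T allV (ne ∘ ≡.sym) (ne ∘ ≡.sym) (≡.trans (symmetric′ s a) (≡.trans (shifted-In₁ (∈V₁ a∈) s) (symmetric a _))))
        (λ a∈ → let ne = proj₂ (∈V₁ a∈) in move-entry T′ allV T allV ne ne (shifted-In₁ (∈V₁ a∈) s))
        (λ {a} {b} a∈ _ → entry-cong T′ allV T allV a b (shifted-In₁ (∈V₁ a∈) _) (count-cong (shifted-In₁ (∈V₁ a∈))))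

      V₂-offCorner : offCorner (M₂ s) M₂ s V₂ ≈ Y₂
      V₂-offCorner = offCorner-cong
        (λ {a} a∈ → let ne = In₂-offPath (∈V₂ a∈) zero ; ne′ = proj₂ (∈V₂ a∈) in
          move-entry T′ allV T allV ne (ne′ ∘ ≡.sym) (≡.trans (symmetric′ s a) (≡.trans (shifted-In₂-s (∈V₂ a∈)) (symmetric a _))))
        (λ a∈ → let ne = In₂-offPath (∈V₂ a∈) zero ; ne′ = proj₂ (∈V₂ a∈) in
          move-entry T′ allV T allV (ne ∘ ≡.sym) ne′ (shifted-In₂-s (∈V₂ a∈)))
        (λ {a} {b} a∈ b∈ → entry-cong T′ allV T allV a b
          (shifted-In₂ (∈V₂ a∈) (In₂-offPath (∈V₂ b∈) zero ∘ ≡.sym) (proj₂ (∈V₂ b∈)))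
          (count-shifted-In₂ (∈V₂ a∈)))

      charPoly-T′ : charPoly T′ allV q x ≈
        Y₁ * (D₂ * ε) + D₁ * (Y₂ * ε + D₂ * wholePath q t (δ (k₁ + 1# + k₂)) (δ 1#) m)
      charPoly-T′ = begin
        charPoly T′ allV q x
          ≈⟨ detOn-↭ T′ allV allV (vertices-all allV (λ _ → ≡.refl)) ⟩
        minor M₂ (s ∷ V₁ ++ (e ∷ Q ++ V₂))
          ≈⟨ minor-join chain₂
               (λ i → trans (diagonal-count T′ allV (internal i) (≡.trans (count-cong (shifted-internal i)) (count-T-internal i))) (δ-cong two))
               (trans (diagonal-count T′ allV s count-shifted-s)
                 (δ-cong (trans (×-homo-+ 1# (degree₁ ℕ.+ 1) degree₂) (+-congʳ (trans (×-homo-+ 1# degree₁ 1) (+-congˡ one))))))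
               (trans (diagonal-count T′ allV e count-shifted-e) (δ-cong one))
               s∉V₁ (λ b∈ → In₁-∉ b∈ ∘ ∈V₁) (path∉V₂ zero) e∷Q∉V₂
               (separated T′ allV symmetric′ V₁-apart′) (separated T′ allV symmetric′ V₂-apart′) ⟩
        _ ≈⟨ +-cong (*-cong V₁-offCorner (*-congʳ V₂-minor))
                    (*-cong V₁-minor (+-cong (*-congʳ V₂-offCorner) (*-congʳ V₂-minor))) ⟩
        Y₁ * (D₂ * ε) + D₁ * (Y₂ * ε + D₂ * wholePath q t (δ (k₁ + 1# + k₂)) (δ 1#) m) ∎

      private
        c′ = x + q * q - 1#

      auxPoly-path : auxPoly PE onPath s q x ≈ wholePath q t (δ 1#) (δ 1#) m - c′ * ε
      auxPoly-path = minus-cong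
        (trans (detOn-↭ PE onPath onPath vertices-path) (minor-both chainP inner-diag start-diag end-diag))
        (*-congˡ (trans (detOn-↭ PE onPath (without onPath s) vertices-path⁻) (minor-end chainP inner-diag start-diag end-diag)))
        where
        inner-diag : ∀ i → M PE onPath (internal i) (internal i) ≈ t
        inner-diag i = trans (diagonal-count PE onPath (internal i)
          (≡.trans (count-cong (λ v → ≡.trans (≡.sym (onPath-row _ v)) (≡.sym (internal-row i v)))) (count-T-internal i))) (δ-cong two)
        start-diag : M PE onPath s s ≈ δ 1#
        start-diag = trans (diagonal-count PE onPath s (≡.trans (count-cong (≡.sym ∘ onPath-row s)) count-PE-start)) (δ-cong one)
        end-diag : M PE onPath e e ≈ δ 1#
        end-diag = trans (diagonal-count PE onPath e (≡.trans (count-cong (≡.sym ∘ onPath-row e)) count-PE-end)) (δ-cong one)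

      -- The matrix of the branch differs from that of the whole tree only in the diagonal entry of
      -- the root, where the path edge is not counted. Since D and Y avoid this entry, they can be
      -- read off from the tree.
      auxPoly-rooted : ∀ S v {d} → S v ≡ true → (∀ a → without S v a ≡ true → ∀ b → T a b ≡ S b ∧ N a b) →
        (∀ {a} → without S v a ≡ true → T a v ≡ N a v) →
        count (λ b → S b ∧ N v b) ≡ d →
        auxPoly N S v q x ≈ (δ (d · 1#) * minor M₁ (vertices (without S v)) + offCorner (M₁ v) M₁ v (vertices (without S v)))
                              - c′ * minor M₁ (vertices (without S v))
      auxPoly-rooted S v {d} v∈ row root h = minus-cong
        (trans (detOn-↭ N S S (vertices-∷-↭ S v∈)) (+-cong (*-cong (diagonal-count N S v h) same) sameOff))
        (*-congˡ (trans (detOn-minor (without S v) (M N S)) same))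
        where
        V = vertices (without S v)
        in-S : ∀ {a} → a ∈ V → without S v a ≡ true
        in-S = ∈-vertices⁻ (without S v)
        T-N : ∀ {a b} → a ∈ V → b ∈ V → N a b ≡ T a b
        T-N {a} {b} a∈ b∈ = ≡.sym (≡.trans (row a (in-S a∈) b)
          (≡.cong (_∧ N a b) (proj₁ (without⁻ {S = S} (in-S b∈)))))
        entries≈ : ∀ {a b} → a ∈ V → b ∈ V → M N S a b ≈ M₁ a b
        entries≈ {a} {b} a∈ b∈ = entry-cong N S T allV a b (T-N a∈ b∈) (count-cong (λ u → ≡.sym (row a (in-S a∈) u)))
        same : minor (M N S) V ≈ minor M₁ V
        same = minor-cong entries≈
        sameOff : offCorner (M N S v) (M N S) v V ≈ offCorner (M₁ v) M₁ v V
        sameOff = offCorner-cong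
          (λ a∈ → let ne = proj₂ (without⁻ {S = S} (in-S a∈)) in
            move-entry N S T allV (ne ∘ ≡.sym) (ne ∘ ≡.sym) (≡.trans (N-sym _ _) (≡.trans (≡.sym (root (in-S a∈))) (symmetric _ _))))
          (λ a∈ → let ne = proj₂ (without⁻ {S = S} (in-S a∈)) in move-entry N S T allV ne ne (≡.sym (root (in-S a∈))))
          entries≈

      identity : GTSIdentity T T′ P S₁ S₂ q x
      identity = begin
        ((q * q) * x) * (charPoly T allV q x - charPoly T′ allV q x)
          ≈⟨ *-congˡ (minus-cong charPoly-T charPoly-T′) ⟩
        _ ≈⟨ shift-identity q x k₁ k₂ D₁ D₂ Y₁ Y₂ m ⟩
        _ ≈⟨ -‿cong (*-cong (*-cong auxPoly-path aux₁) aux₂) ⟨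
        - ((auxPoly PE onPath s q x * auxPoly N S₁ s q x) * auxPoly N S₂ e q x) ∎
        where
        aux₁ = auxPoly-rooted S₁ s S₁-s
          (λ a h → In₁-row (without⁻ {S = S₁} h))
          (λ {a} h → ≡.trans (In₁-row (without⁻ {S = S₁} h) s) (≡.cong (_∧ N a s) S₁-s)) ≡.refl
        aux₂ = auxPoly-rooted S₂ e S₂-e
          (λ a h → In₂-row (without⁻ {S = S₂} h))
          (λ {a} h → ≡.trans (In₂-row (without⁻ {S = S₂} h) e) (≡.cong (_∧ N a e) S₂-e)) ≡.refl

theorem3p4 : ∀ {c ℓ₁ ℓ₂} (F : HeytingField c ℓ₁ ℓ₂) →
    ∀ {n} (T₁ T₂ : Graph n) → IsTree T₁ → IsTree T₂ →
    (m : ℕ) (P : Path T₁ m) → Path.InternalDeg2 P →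
    2 ≤ deg T₁ (Path.start P) → 2 ≤ deg T₁ (Path.end P) →
    T₂ ≡ shiftAlong P → Covers T₂ T₁ →
    (S₁ S₂ : Fin n → Bool) →
    (∀ v → (S₁ v ≡ true) ⇔ Walk (Path.minusPath P) (Path.start P) v) →
    (∀ v → (S₂ v ≡ true) ⇔ Walk (Path.minusPath P) (Path.end P) v) →
    (q : HeytingField.Carrier F) → HeytingField._#_ F q (HeytingField.0# F) →
    (x : HeytingField.Carrier F) →
    WithField.GTSIdentity F T₁ T₂ P S₁ S₂ q x
theorem3p4 F T₁ T₂ tree₁ tree₂ m P deg2 _ _ ≡.refl _ S₁ S₂ walk₁ walk₂ q _ x =
  Assembly.identity F q x tree₁ P deg2 tree₂ S₁ S₂ walk₁ walk₂
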